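{- Let $m\ge 7$ be an odd integer and let $F$ be a bipartite directed $2$-factor of order $2m$. If there exists an $F$-factorization of $W_{2m}^*$, then there exists an $F$-factorization of $K_{2m}^*$.
   Context: A directed $2$-factor $[m_1,\ldots,m_t]$ of order $m_1+\cdots+m_t$ is a digraph consisting of vertex-disjoint directed cycles of lengths $m_1,\ldots,m_t$ (each $m_i\ge2$; a directed $2$-cycle on $\{u,v\}$ consists of arcs $uv$ and $vu$); it is bipartite if all $m_i$ are even. $W_{2m}$ is the lexicographic product $\mathrm{Circ}(m,\{\pm1,\pm2\})[K_2]$: vertex set $\{x_i,y_i : i\in\mathbb{Z}_m\}$, where $x_i$ is adjacent to $y_i$, and each of $x_i,y_i$ is adjacent to each of $x_j,y_j$ whenever $i-j\in\{\pm1,\pm2\}$ in $\mathbb{Z}_m$. For a graph $G$, $G^*$ is the digraph obtained by replacing each edge $\{u,v\}$ by the arcs $uv$ and $vu$; $K_{2m}^*$ is the complete symmetric digraph on $2m$ vertices. An $F$-factorization of a digraph $D$ is a partition of the arc set of $D$ into spanning subdigraphs each isomorphic to $F$. -}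

module Defs where

open import Data.Nat using (ℕ; zero; suc; _+_; _*_; _≤_)
open import Data.Nat.Divisibility using (_∣_)
open import Data.Fin using (Fin; toℕ)
open import Data.List using (List; length; lookup)
open import Data.Nat.ListAction using (sum)
open import Data.List.Relation.Unary.All using (All)
open import Data.Product using (Σ; _×_; _,_; proj₁; proj₂)
open import Data.Sum using (_⊎_)
open import Relation.Binary.PropositionalEquality using (_≡_)
open import Relation.Nullary using (¬_)
open import Function.Bundles using (_↔_; Inverse; _⇔_)
open import Level using (0ℓ)

Digraph : Set → Set₁
Digraph V = V → V → Set

-- A directed 2-factor [m_1,...,m_t] is given by its list of cycle lengths.
-- It is a directed 2-factor if every length is ≥ 2, bipartite if all are even.
IsDirected2Factor : List ℕ → Set
IsDirected2Factor ms = All (2 ≤_) ms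

IsBipartite2Factor : List ℕ → Set
IsBipartite2Factor ms = IsDirected2Factor ms × All (2 ∣_) ms

order : List ℕ → ℕ
order ms = sum ms

-- The concrete digraph [m_1,...,m_t]: vertex (i , a) is vertex a of the i-th cycle
FVert : List ℕ → Set
FVert ms = Σ (Fin (length ms)) (λ i → Fin (lookup ms i))

FArc : (ms : List ℕ) → Digraph (FVert ms)
FArc ms (i , a) (j , b) =
  i ≡ j × ((toℕ b ≡ suc (toℕ a)) ⊎ (toℕ b ≡ 0 × suc (toℕ a) ≡ lookup ms i))

IsoTo2Factor : {V : Set} → Digraph V → List ℕ → Set
IsoTo2Factor {V} H ms =
  Σ (V ↔ FVert ms) λ φ → ∀ u v → H u v ⇔ FArc ms (Inverse.to φ u) (Inverse.to φ v)

Factorization : {V : Set} → List ℕ → Digraph V → Set₁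
Factorization {V} F D =
  Σ ℕ λ k → Σ (Fin k → Digraph V) λ H →
    (∀ i → IsoTo2Factor (H i) F) ×
    (∀ i u v → H i u v → D u v) ×
    (∀ u v → D u v → Σ (Fin k) λ i → H i u v × (∀ j → H j u v → j ≡ i))

Kstar : (n : ℕ) → Digraph (Fin n)
Kstar n u v = ¬ (u ≡ v)

-- i - j ≡ d (mod m) for i j : Fin m, d ≤ m
DiffMod : (m : ℕ) → Fin m → Fin m → ℕ → Set
DiffMod m i j d = (toℕ i ≡ toℕ j + d) ⊎ (toℕ i + m ≡ toℕ j + d)

CircAdj : (m : ℕ) → Fin m → Fin m → Set
CircAdj m i j = DiffMod m i j 1 ⊎ DiffMod m j i 1 ⊎ DiffMod m i j 2 ⊎ DiffMod m j i 2

-- W_{2m}^* on vertex set Z_m × {x,y} (Fin 2: 0 = x, 1 = y)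
Wstar : (m : ℕ) → Digraph (Fin m × Fin 2)
Wstar m (i , a) (j , b) = (i ≡ j × ¬ (a ≡ b)) ⊎ CircAdj m i j

{-# OPTIONS --safe #-}
module Submission where

-- Every arc of K*_{2m} outside W*_{2m} joins vertices over two elements of Z_m whose difference is one of
-- ±3, …, ±k, where m = 2k + 1.  A Hamilton cycle of K_m, with every vertex doubled and every edge taken in
-- both directions, splits into four copies of F (a directed form of Häggkvist's lemma), so it suffices to
-- decompose the circulant graph on Z_m with differences 3, …, k into Hamilton cycles.  A single leftover
-- difference k is a unit.  The other differences a, b are taken in consecutive pairs: the a-edges form
-- d = gcd(a,m) cycles and the b-edges form e = gcd(b,m) cycles, say d > e unless both are 1, and letting the a-edges and the b-edges of
-- d - 1 well-chosen 4-cycles x, x+a, x+a+b, x+b trade places turns both 2-factors into Hamilton cycles.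

open import Defs
open import Data.Bool using (Bool; true; false; not)
open import Data.Empty using (⊥; ⊥-elim)
open import Data.Fin using (Fin; zero; suc; toℕ; fromℕ<; _↑ˡ_; _↑ʳ_; splitAt; join; opposite; combine; remQuot; punchOut; _≟_)
open import Data.Fin.Patterns using (0F; 1F; 2F; 3F)
open import Data.Fin.Properties using (splitAt-join; join-splitAt; toℕ-injective; toℕ<n; toℕ-↑ˡ; toℕ-↑ʳ; opposite-prop; opposite-involutive; toℕ-fromℕ<; +↔⊎; *↔×; all?; any?; pigeonhole; injective⇒≤; combine-remQuot; punchOut-injective)
open import Data.List using (List; []; _∷_)
open import Data.List.Relation.Unary.All using (All; []; _∷_)
open import Data.Nat using (ℕ; zero; suc; pred; _+_; _*_; _∸_; _/_; _%_; _≤_; _<_; z≤n; s≤s; _<?_; NonZero; >-nonZero; ≢-nonZero; ≢-nonZero⁻¹)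
open import Data.Nat.Coprimality using (Coprime; coprime?; coprime-divisor; coprime-/gcd; coprime-Bézout; gcd≡1⇒coprime) renaming (sym to coprime-sym)
open import Data.Nat.Divisibility
open import Data.Nat.DivMod
open import Data.Nat.GCD using (gcd; gcd[m,n]∣m; gcd[m,n]∣n; gcd[m,n]≢0; module Bézout)
open import Data.Nat.Properties hiding (_≟_)
import Data.Nat.Properties as ℕ
open import Data.Product using (Σ; _×_; _,_; proj₁; proj₂)
open import Data.Product.Algebra using (×-comm)
open import Data.Product.Function.NonDependent.Propositional using (_×-↔_)
open import Data.Sum using (_⊎_; inj₁; inj₂; [_,_]′; swap)
import Data.Sum as Sum
open import Data.Sum.Function.Propositional using (_⊎-↔_)
open import Data.Unit using (tt)
open import Function.Bundles using (_↔_; _⇔_; Inverse; Injection; Equivalence; mk↔ₛ′; mk⇔)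
open import Function.Construct.Composition using (_↔-∘_)
open import Function.Construct.Identity using (↔-id)
open import Function.Construct.Symmetry using (↔-sym)
open import Function.Properties.Inverse using (↔⇒↣)
open import Relation.Binary.Construct.Closure.ReflexiveTransitive using (Star; ε; _◅_; _◅◅_; reverse)
open import Relation.Binary.Definitions using (tri<; tri≈; tri>)
open import Relation.Binary.PropositionalEquality hiding (isEquivalence)
open import Relation.Binary.Structures using (IsEquivalence)
open import Relation.Nullary using (¬_; yes; no; ¬?)
open import Relation.Nullary.Decidable using (toWitness; _×-dec_; _→-dec_; _⊎-dec_)
open import Relation.Unary using (Decidable)

-- Operations on factorizations

-- A difference that is not a unit gives several short cycles, and joining them needs the edges of a
-- second difference. Joining `d` cycles takes at least `d - 1` switches; placing switch `i` between
-- the rows `i` and `i + 1` of the grid `v₀ + i b + j a` leaves only its column `c i` to be chosen.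
-- The same switches act on the `b`-edges, whose cycles are the `e` columns, or one single cycle if
-- `e = 1`. There are more switches than the `e - 1` that would do there, and the surplus must cause
-- no harm. Hence the shape of `c`: the columns 0, 1, 0, 1, ... on an even number of levels have the
-- effect of just two switches on the columns 0, 1, 2, and each later switch attaches one further
-- column. Odd `m` makes `d` and `e` odd and so this number of levels even. In the doubling lemma
-- the obstacle is that an odd cycle has no proper 2-colouring; four copies still suffice, because
-- F₂² has three nonzero functionals, one for each colour of a proper 3-colouring.

module _ {V : Set} (F : List ℕ) where

  factorization-cong : {D D′ : Digraph V} → (∀ {u v} → D u v → D′ u v) → (∀ {u v} → D′ u v → D u v) →
                       Factorization F D → Factorization F D′
  factorization-cong to from (k , H , iso , sub , cov) =
    k , H , iso , (λ i u v h → to (sub i u v h)) , (λ u v d → cov u v (from d))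

  factorization-∅ : Factorization {V} F (λ _ _ → ⊥)
  factorization-∅ = 0 , (λ ()) , (λ ()) , (λ ()) , (λ u v ())

  factorization-∪ : {D₁ D₂ : Digraph V} → (∀ {u v} → D₁ u v → ¬ D₂ u v) →
                    Factorization F D₁ → Factorization F D₂ → Factorization F (λ u v → D₁ u v ⊎ D₂ u v)
  factorization-∪ {D₁} {D₂} disj (k₁ , H₁ , iso₁ , sub₁ , cov₁) (k₂ , H₂ , iso₂ , sub₂ , cov₂) =
    k₁ + k₂ , (λ i → H′ (splitAt k₁ i)) , (λ i → iso (splitAt k₁ i)) , (λ i → sub (splitAt k₁ i)) , cov
    where
    H′ : Fin k₁ ⊎ Fin k₂ → Digraph V
    H′ = [ H₁ , H₂ ]′
    iso : ∀ s → IsoTo2Factor (H′ s) F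
    iso (inj₁ i) = iso₁ i
    iso (inj₂ i) = iso₂ i
    sub : ∀ s u v → H′ s u v → D₁ u v ⊎ D₂ u v
    sub (inj₁ i) u v h = inj₁ (sub₁ i u v h)
    sub (inj₂ i) u v h = inj₂ (sub₂ i u v h)
    cov′ : ∀ u v → D₁ u v ⊎ D₂ u v → Σ (Fin k₁ ⊎ Fin k₂) λ s → H′ s u v × (∀ s′ → H′ s′ u v → s′ ≡ s)
    cov′ u v (inj₁ d) with i , h , uniq ← cov₁ u v d =
      inj₁ i , h , λ { (inj₁ j) h′ → cong inj₁ (uniq j h′) ; (inj₂ j) h′ → ⊥-elim (disj d (sub₂ j u v h′)) }
    cov′ u v (inj₂ d) with i , h , uniq ← cov₂ u v d =
      inj₂ i , h , λ { (inj₂ j) h′ → cong inj₂ (uniq j h′) ; (inj₁ j) h′ → ⊥-elim (disj (sub₁ j u v h′) d) }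
    cov : ∀ u v → D₁ u v ⊎ D₂ u v →
          Σ (Fin (k₁ + k₂)) λ i → H′ (splitAt k₁ i) u v × (∀ j → H′ (splitAt k₁ j) u v → j ≡ i)
    cov u v d with s , h , uniq ← cov′ u v d =
      join k₁ k₂ s , subst (λ z → H′ z u v) (sym (splitAt-join k₁ k₂ s)) h ,
      λ j h′ → trans (sym (join-splitAt k₁ k₂ j)) (cong (join k₁ k₂) (uniq (splitAt k₁ j) h′))

factorization-pullback : {V W : Set} (F : List ℕ) {D : Digraph V} (g : W ↔ V) →
                         Factorization F D → Factorization F (λ u v → D (Inverse.to g u) (Inverse.to g v))
factorization-pullback F g (k , H , iso , sub , cov) =
  k , (λ i u v → H i (to u) (to v)) , (λ i → proj₁ (iso i) ↔-∘ g , λ u v → proj₂ (iso i) (to u) (to v)) ,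
  (λ i u v → sub i (to u) (to v)) , (λ u v → cov (to u) (to v))
  where open Inverse g using (to)

-- Unfolding a bipartite 2-factor

data Dir : Set where
  up down : Dir

-- A cycle of length 2ℓ is folded over ℓ consecutive gaps: it passes them upwards, then
-- the same gaps downwards.
data Move {n : ℕ} : Fin n × Dir → Fin n × Dir → Set where
  rise : ∀ {j j′} → toℕ j′ ≡ suc (toℕ j) → Move (j , up) (j′ , up)
  turn↓ : ∀ {j j′} → j′ ≡ j → Move (j , up) (j′ , down)
  sink : ∀ {j j′} → toℕ j ≡ suc (toℕ j′) → Move (j , down) (j′ , down)
  turn↑ : ∀ {j j′} → j′ ≡ j → Move (j , down) (j′ , up)

FVert-∷ : ∀ x xs → FVert (x ∷ xs) ↔ (Fin x ⊎ FVert xs)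
FVert-∷ x xs = mk↔ₛ′ to from (λ { (inj₁ _) → refl ; (inj₂ _) → refl })
                 (λ { (zero , _) → refl ; (suc _ , _) → refl })
  where
  to : FVert (x ∷ xs) → Fin x ⊎ FVert xs
  to (zero , a) = inj₁ a
  to (suc i , a) = inj₂ (i , a)
  from : Fin x ⊎ FVert xs → FVert (x ∷ xs)
  from (inj₁ a) = zero , a
  from (inj₂ (i , a)) = suc i , a

fold : ∀ q → (Fin q ⊎ Fin q) ↔ (Fin q × Dir)
fold q = mk↔ₛ′ to from to-from from-to
  where
  to : Fin q ⊎ Fin q → Fin q × Dir
  to (inj₁ i) = i , up
  to (inj₂ i) = opposite i , down
  from : Fin q × Dir → Fin q ⊎ Fin q
  from (i , up) = inj₁ i
  from (i , down) = inj₂ (opposite i)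
  to-from : ∀ p → to (from p) ≡ p
  to-from (i , up) = refl
  to-from (i , down) = cong (_, down) (opposite-involutive i)
  from-to : ∀ s → from (to s) ≡ s
  from-to (inj₁ i) = refl
  from-to (inj₂ i) = cong inj₂ (opposite-involutive i)

glue : ∀ q n → ((Fin q × Dir) ⊎ (Fin n × Dir)) ↔ (Fin (q + n) × Dir)
glue q n = mk↔ₛ′ to (λ (j , s) → from (splitAt q j) s) to-from from-to
  where
  to : (Fin q × Dir) ⊎ (Fin n × Dir) → Fin (q + n) × Dir
  to (inj₁ (j , s)) = j ↑ˡ n , s
  to (inj₂ (j , s)) = q ↑ʳ j , s
  from : Fin q ⊎ Fin n → Dir → (Fin q × Dir) ⊎ (Fin n × Dir)
  from (inj₁ j) s = inj₁ (j , s)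
  from (inj₂ j) s = inj₂ (j , s)
  to-from′ : ∀ x s → to (from x s) ≡ (join q n x , s)
  to-from′ (inj₁ _) s = refl
  to-from′ (inj₂ _) s = refl
  to-from : ∀ p → to (from (splitAt q (proj₁ p)) (proj₂ p)) ≡ p
  to-from (j , s) = trans (to-from′ (splitAt q j) s) (cong (_, s) (join-splitAt q n j))
  from-to : ∀ x → from (splitAt q (proj₁ (to x))) (proj₂ (to x)) ≡ x
  from-to (inj₁ (j , s)) = cong (λ z → from z s) (splitAt-join q n (inj₁ j))
  from-to (inj₂ (j , s)) = cong (λ z → from z s) (splitAt-join q n (inj₂ j))

module _ {q n : ℕ} where

  glue-moveˡ : ∀ {p p′} → Move p p′ → Move (Inverse.to (glue q n) (inj₁ p)) (Inverse.to (glue q n) (inj₁ p′))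
  glue-moveˡ (rise {j} {j′} e) = rise (trans (toℕ-↑ˡ j′ n) (trans e (cong suc (sym (toℕ-↑ˡ j n)))))
  glue-moveˡ (turn↓ e) = turn↓ (cong (_↑ˡ n) e)
  glue-moveˡ (sink {j} {j′} e) = sink (trans (toℕ-↑ˡ j n) (trans e (cong suc (sym (toℕ-↑ˡ j′ n)))))
  glue-moveˡ (turn↑ e) = turn↑ (cong (_↑ˡ n) e)

  ↑ʳ-suc : ∀ {j j′ : Fin n} → toℕ j′ ≡ suc (toℕ j) → toℕ (q ↑ʳ j′) ≡ suc (toℕ (q ↑ʳ j))
  ↑ʳ-suc {j} {j′} e = trans (toℕ-↑ʳ q j′) (trans (cong (q +_) e) (trans (+-suc q _) (cong suc (sym (toℕ-↑ʳ q j)))))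

  glue-moveʳ : ∀ {p p′} → Move p p′ → Move (Inverse.to (glue q n) (inj₂ p)) (Inverse.to (glue q n) (inj₂ p′))
  glue-moveʳ (rise e) = rise (↑ʳ-suc e)
  glue-moveʳ (turn↓ e) = turn↓ (cong (q ↑ʳ_) e)
  glue-moveʳ (sink e) = sink (↑ʳ-suc e)
  glue-moveʳ (turn↑ e) = turn↑ (cong (q ↑ʳ_) e)

module _ {q : ℕ} where

  opp-toℕ : (j : Fin q) → toℕ (opposite j) + suc (toℕ j) ≡ q
  opp-toℕ j = trans (cong (_+ suc (toℕ j)) (opposite-prop j)) (m∸n+n≡m (toℕ<n j))

  -- The arc from the first half of the cycle into the second is the turn at the top gap `q - 1`,
  -- and the closing arc is the turn at gap 0. The other crossings between the halves are excluded
  -- by size.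
  fold-move : ∀ (x y : Fin q ⊎ Fin q) →
              (toℕ (join q q y) ≡ suc (toℕ (join q q x))) ⊎ (toℕ (join q q y) ≡ 0 × suc (toℕ (join q q x)) ≡ q + q) →
              Move (Inverse.to (fold q) x) (Inverse.to (fold q) y)
  fold-move (inj₁ a) (inj₁ b) (inj₁ e) = rise (trans (sym (toℕ-↑ˡ b q)) (trans e (cong suc (toℕ-↑ˡ a q))))
  fold-move (inj₁ a) (inj₁ b) (inj₂ (_ , e)) =
    ⊥-elim (<-irrefl (trans (cong suc (sym (toℕ-↑ˡ a q))) e)
                     (≤-<-trans (toℕ<n a) (m<m+n q (≤-<-trans z≤n (toℕ<n a)))))
  fold-move (inj₁ a) (inj₂ b) (inj₁ e) = turn↓ (toℕ-injective (+-cancelʳ-≡ 1 _ _ lem))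
    where
    e′ : q + toℕ b ≡ suc (toℕ a)
    e′ = trans (sym (toℕ-↑ʳ q b)) (trans e (cong suc (toℕ-↑ˡ a q)))
    b≡0 : toℕ b ≡ 0
    b≡0 = n≤0⇒n≡0 (+-cancelˡ-≤ q _ _ (subst (_≤ q + 0) (sym e′) (≤-trans (toℕ<n a) (m≤m+n q 0))))
    lem : toℕ (opposite b) + 1 ≡ toℕ a + 1
    lem = begin
      toℕ (opposite b) + 1 ≡⟨ cong (λ z → toℕ (opposite b) + suc z) b≡0 ⟨
      toℕ (opposite b) + suc (toℕ b) ≡⟨ opp-toℕ b ⟩
      q ≡⟨ +-identityʳ q ⟨
      q + 0 ≡⟨ cong (q +_) b≡0 ⟨
      q + toℕ b ≡⟨ e′ ⟩
      suc (toℕ a) ≡⟨ +-comm 1 _ ⟩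
      toℕ a + 1 ∎
      where open ≡-Reasoning
  fold-move (inj₁ a) (inj₂ b) (inj₂ (e , _)) with () ← subst Fin (m+n≡0⇒m≡0 q (trans (sym (toℕ-↑ʳ q b)) e)) a
  fold-move (inj₂ a) (inj₁ b) (inj₁ e) = ⊥-elim (<-irrefl e′ (≤-trans (toℕ<n b) (≤-trans (m≤m+n q (toℕ a)) (n≤1+n _))))
    where
    e′ : toℕ b ≡ suc (q + toℕ a)
    e′ = trans (sym (toℕ-↑ˡ b q)) (trans e (cong suc (toℕ-↑ʳ q a)))
  fold-move (inj₂ a) (inj₁ b) (inj₂ (e₁ , e₂)) = turn↑ (toℕ-injective (trans b≡0 (sym opp≡0)))
    where
    b≡0 : toℕ b ≡ 0
    b≡0 = trans (sym (toℕ-↑ˡ b q)) e₁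
    sa≡q : suc (toℕ a) ≡ q
    sa≡q = +-cancelˡ-≡ q _ _ (trans (+-suc q _) (trans (cong suc (sym (toℕ-↑ʳ q a))) e₂))
    opp≡0 : toℕ (opposite a) ≡ 0
    opp≡0 = trans (opposite-prop a) (trans (cong (q ∸_) sa≡q) (n∸n≡0 q))
  fold-move (inj₂ a) (inj₂ b) (inj₁ e) = sink (+-cancelʳ-≡ (suc (toℕ a)) _ _ lem)
    where
    e′ : toℕ b ≡ suc (toℕ a)
    e′ = +-cancelˡ-≡ q _ _ (trans (sym (toℕ-↑ʳ q b)) (trans e (trans (cong suc (toℕ-↑ʳ q a)) (sym (+-suc q _)))))
    lem : toℕ (opposite a) + suc (toℕ a) ≡ suc (toℕ (opposite b)) + suc (toℕ a)
    lem = trans (opp-toℕ a) (trans (sym (opp-toℕ b)) (trans (+-suc _ _) (cong (λ z → suc (toℕ (opposite b) + z)) e′)))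
  fold-move (inj₂ a) (inj₂ b) (inj₂ (e , _)) with () ← subst Fin (m+n≡0⇒m≡0 q (trans (sym (toℕ-↑ʳ q b)) e)) a

Unfolding : List ℕ → ℕ → Set
Unfolding F n = Σ (FVert F ↔ (Fin n × Dir)) λ Φ → ∀ u v → FArc F u v → Move (Inverse.to Φ u) (Inverse.to Φ v)

-- The cycles take consecutive blocks of gaps. Each gap is used once upwards and once downwards, so
-- half the order is the number of gaps.
unfold : ∀ F → All (2 ∣_) F → Σ ℕ λ n → order F ≡ 2 * n × Unfolding F n
unfold [] [] = 0 , refl , mk↔ₛ′ (λ ()) (λ ()) (λ ()) (λ ()) , λ ()
unfold (x ∷ xs) (divides q x≡q*2 ∷ evens) with unfold xs evens
... | n , eq , Φ , moves with x≡q+q ← trans x≡q*2 (trans (*-comm q 2) (cong (q +_) (+-identityʳ q)))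
    with refl ← x≡q+q = q + n , order≡ , Φ′ , moves′
  where
  order≡ : q + q + order xs ≡ 2 * (q + n)
  order≡ = trans (cong₂ _+_ (cong (q +_) (sym (+-identityʳ q))) eq) (sym (*-distribˡ-+ 2 q n))
  Φ′ : FVert (q + q ∷ xs) ↔ (Fin (q + n) × Dir)
  Φ′ = glue q n ↔-∘ (((fold q ↔-∘ +↔⊎) ⊎-↔ Φ) ↔-∘ FVert-∷ (q + q) xs)
  moves′ : ∀ u v → FArc (q + q ∷ xs) u v → Move (Inverse.to Φ′ u) (Inverse.to Φ′ v)
  moves′ (zero , a) (zero , b) (_ , e) = glue-moveˡ (fold-move (splitAt q a) (splitAt q b)
    (subst₂ (λ a b → (toℕ b ≡ suc (toℕ a)) ⊎ (toℕ b ≡ 0 × suc (toℕ a) ≡ q + q))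
      (sym (join-splitAt q q a)) (sym (join-splitAt q q b)) e))
  moves′ (suc i , a) (suc .i , b) (refl , e) = glue-moveʳ (moves (i , a) (i , b) (refl , e))

FArc-total : ∀ F u → Σ (FVert F) (FArc F u)
FArc-total F (i , a) with m≤n⇒m<n∨m≡n (toℕ<n a)
... | inj₁ a+1<n = (i , fromℕ< a+1<n) , refl , inj₁ (toℕ-fromℕ< a+1<n)
... | inj₂ a+1≡n = (i , fromℕ< 0<n) , refl , inj₂ (toℕ-fromℕ< 0<n , a+1≡n)
  where 0<n = ≤-<-trans z≤n (toℕ<n a)

-- With `FArc-total`, every vertex has exactly one out-neighbour: an arc of a copy is known once its
-- tail is.
FArc-functional : ∀ F {u v w} → FArc F u v → FArc F u w → v ≡ w
FArc-functional F {_ , a} {_ , b} {_ , c} (refl , e) (refl , e′) = cong (_ ,_) (toℕ-injective (lem e e′))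
  where
  lem : _ → _ → toℕ b ≡ toℕ c
  lem (inj₁ p) (inj₁ q) = trans p (sym q)
  lem (inj₁ p) (inj₂ (_ , q)) = ⊥-elim (<-irrefl (trans p q) (toℕ<n b))
  lem (inj₂ (_ , p)) (inj₁ q) = ⊥-elim (<-irrefl (trans q p) (toℕ<n c))
  lem (inj₂ (p , _)) (inj₂ (q , _)) = trans p (sym q)

-- The cyclic group Z_m

module Zmod (m : ℕ) .{{_ : NonZero m}} where

  infixl 6 _⊞_
  _⊞_ : Fin m → ℕ → Fin m
  i ⊞ d = fromℕ< (m%n<n (toℕ i + d) m)

  toℕ-⊞ : ∀ i d → toℕ (i ⊞ d) ≡ (toℕ i + d) % m
  toℕ-⊞ i d = toℕ-fromℕ< _

  [m%n+o]%n≡[m+o]%n : ∀ a b → (a % m + b) % m ≡ (a + b) % m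
  [m%n+o]%n≡[m+o]%n a b = begin
    (a % m + b) % m           ≡⟨ %-distribˡ-+ (a % m) b m ⟩
    (a % m % m + b % m) % m   ≡⟨ cong (λ z → (z + b % m) % m) (m%n%n≡m%n a m) ⟩
    (a % m + b % m) % m       ≡⟨ %-distribˡ-+ a b m ⟨
    (a + b) % m               ∎
    where open ≡-Reasoning

  ⊞-⊞ : ∀ i d e → i ⊞ d ⊞ e ≡ i ⊞ (d + e)
  ⊞-⊞ i d e = toℕ-injective (begin
    toℕ (i ⊞ d ⊞ e)            ≡⟨ toℕ-⊞ (i ⊞ d) e ⟩
    (toℕ (i ⊞ d) + e) % m      ≡⟨ cong (λ z → (z + e) % m) (toℕ-⊞ i d) ⟩
    ((toℕ i + d) % m + e) % m  ≡⟨ [m%n+o]%n≡[m+o]%n (toℕ i + d) e ⟩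
    (toℕ i + d + e) % m        ≡⟨ cong (_% m) (+-assoc (toℕ i) d e) ⟩
    (toℕ i + (d + e)) % m      ≡⟨ toℕ-⊞ i (d + e) ⟨
    toℕ (i ⊞ (d + e))          ∎)
    where open ≡-Reasoning

  ⊞-comm : ∀ i d e → i ⊞ d ⊞ e ≡ i ⊞ e ⊞ d
  ⊞-comm i d e = trans (⊞-⊞ i d e) (trans (cong (i ⊞_) (+-comm d e)) (sym (⊞-⊞ i e d)))

  ⊞-multiple : ∀ i k → i ⊞ (k * m) ≡ i
  ⊞-multiple i k = toℕ-injective
    (trans (toℕ-⊞ i (k * m)) (trans ([m+kn]%n≡m%n (toℕ i) k m) (m<n⇒m%n≡m (toℕ<n i))))

  ⊞-% : ∀ i d → i ⊞ d % m ≡ i ⊞ d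
  ⊞-% i d = toℕ-injective (begin
    toℕ (i ⊞ d % m)       ≡⟨ toℕ-⊞ i (d % m) ⟩
    (toℕ i + d % m) % m   ≡⟨ cong (_% m) (+-comm (toℕ i) _) ⟩
    (d % m + toℕ i) % m   ≡⟨ [m%n+o]%n≡[m+o]%n d (toℕ i) ⟩
    (d + toℕ i) % m       ≡⟨ cong (_% m) (+-comm d _) ⟩
    (toℕ i + d) % m       ≡⟨ toℕ-⊞ i d ⟨
    toℕ (i ⊞ d)           ∎)
    where open ≡-Reasoning

  ⊞-cong-% : ∀ i {d e} → d % m ≡ e % m → i ⊞ d ≡ i ⊞ e
  ⊞-cong-% i {d} {e} eq = trans (sym (⊞-% i d)) (trans (cong (i ⊞_) eq) (⊞-% i e))

  -- Adding ⊖ d subtracts d: d (m - 1) ≡ - d mod m.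
  ⊖_ : ℕ → ℕ
  ⊖ d = d * pred m

  +-⊖ : ∀ d → d + ⊖ d ≡ d * m
  +-⊖ d = trans (sym (*-suc d (pred m))) (cong (d *_) (suc-pred m))

  ⊞-⊖ : ∀ i d → i ⊞ d ⊞ ⊖ d ≡ i
  ⊞-⊖ i d = trans (⊞-⊞ i d (⊖ d)) (trans (cong (i ⊞_) (+-⊖ d)) (⊞-multiple i d))

  ⊖-⊞ : ∀ i d → i ⊞ ⊖ d ⊞ d ≡ i
  ⊖-⊞ i d = trans (⊞-comm i (⊖ d) d) (⊞-⊖ i d)

  ⊞-cancel : ∀ i {d e} → i ⊞ d ≡ i ⊞ e → d % m ≡ e % m
  ⊞-cancel i {d} {e} eq = trans (sym (lem d)) (trans (cong toℕ (cong (_⊞ (m ∸ toℕ i)) eq)) (lem e))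
    where
    lem : ∀ d → toℕ (i ⊞ d ⊞ (m ∸ toℕ i)) ≡ d % m
    lem d = begin
      toℕ (i ⊞ d ⊞ (m ∸ toℕ i))             ≡⟨ cong toℕ (⊞-comm i d _) ⟩
      toℕ (i ⊞ (m ∸ toℕ i) ⊞ d)             ≡⟨ cong toℕ (⊞-⊞ i _ d) ⟩
      toℕ (i ⊞ (m ∸ toℕ i + d))             ≡⟨ toℕ-⊞ i _ ⟩
      (toℕ i + (m ∸ toℕ i + d)) % m         ≡⟨ cong (_% m) (+-assoc (toℕ i) _ d) ⟨
      (toℕ i + (m ∸ toℕ i) + d) % m         ≡⟨ cong (λ z → (z + d) % m) (m+[n∸m]≡n (<⇒≤ (toℕ<n i))) ⟩
      (m + d) % m                           ≡⟨ cong (_% m) (+-comm m d) ⟩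
      (d + m) % m                           ≡⟨ [m+n]%n≡m%n d m ⟩
      d % m                                 ∎
      where open ≡-Reasoning

  ⊞-cancel-< : ∀ i {d e} → d < m → e < m → i ⊞ d ≡ i ⊞ e → d ≡ e
  ⊞-cancel-< i d<m e<m eq = trans (sym (m<n⇒m%n≡m d<m)) (trans (⊞-cancel i eq) (m<n⇒m%n≡m e<m))

  ⊞-0 : ∀ i → i ⊞ 0 ≡ i
  ⊞-0 i = ⊞-multiple i 0

  ⊞-≢ : ∀ i {d} → 0 < d → d < m → i ⊞ d ≢ i
  ⊞-≢ i 0<d d<m eq = <⇒≢ 0<d (sym (⊞-cancel-< i d<m (≤-<-trans z≤n d<m) (trans eq (sym (⊞-0 i)))))

  toℕ-⊞-< : ∀ i d → toℕ i + d < m → toℕ (i ⊞ d) ≡ toℕ i + d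
  toℕ-⊞-< i d lt = trans (toℕ-⊞ i d) (m<n⇒m%n≡m lt)

  suc-cases : ∀ j → (suc (toℕ j) < m × toℕ (j ⊞ 1) ≡ suc (toℕ j)) ⊎ (suc (toℕ j) ≡ m × toℕ (j ⊞ 1) ≡ 0)
  suc-cases j with m≤n⇒m<n∨m≡n (toℕ<n j)
  ... | inj₁ lt = inj₁ (lt , trans (toℕ-⊞-< j 1 (subst (_< m) (+-comm 1 _) lt)) (+-comm _ 1))
  ... | inj₂ eq = inj₂ (eq , trans (toℕ-⊞ j 1)
                               (trans (%-congˡ {o = m} (trans (+-comm (toℕ j) 1) eq)) (n%n≡0 m)))

  Step : ℕ → Fin m → Fin m → Set
  Step d u v = (v ≡ u ⊞ d) ⊎ (u ≡ v ⊞ d)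

  -- Two lengths below `m` can otherwise give the same edge only if `a ≡ - b` modulo `m`, which
  -- `0 < a + b < m` excludes.
  step-unique : ∀ {a b u v} → 0 < a → a + b < m → Step a u v → Step b u v → a ≡ b
  step-unique {a} {b} {u} {v} 0<a lt = go
    where
    a<m : a < m
    a<m = ≤-<-trans (m≤m+n a b) lt
    b<m : b < m
    b<m = ≤-<-trans (m≤n+m b a) lt
    opposed : ∀ {x y} → y ≡ x ⊞ a → x ≢ y ⊞ b
    opposed {x} refl e = ⊞-≢ x (≤-trans 0<a (m≤m+n a b)) lt (trans (sym (⊞-⊞ x a b)) (sym e))
    go : Step a u v → Step b u v → a ≡ b
    go (inj₁ e) (inj₁ e′) = ⊞-cancel-< u a<m b<m (trans (sym e) e′)
    go (inj₂ e) (inj₂ e′) = ⊞-cancel-< v a<m b<m (trans (sym e) e′)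
    go (inj₁ e) (inj₂ e′) = ⊥-elim (opposed e e′)
    go (inj₂ e) (inj₁ e′) = ⊥-elim (opposed e e′)

  StepBetween : ℕ → ℕ → Fin m → Fin m → Set
  StepBetween s k u v = Σ ℕ λ d → s ≤ d × d ≤ k × Step d u v

  Hamiltonian : (Fin m → Fin m → Set) → Set
  Hamiltonian E = Σ (Fin m ↔ Fin m) λ g → ∀ u v → E u v ⇔ Step 1 (Inverse.to g u) (Inverse.to g v)

-- Häggkvist's lemma for directed 2-factors

Lift : ∀ {V : Set} → (V → V → Set) → Digraph (V × Fin 2)
Lift E u v = E (proj₁ u) (proj₁ v)

-- The three nonzero linear functionals on F₂²: any two of them are coordinates.
functional : Fin 3 → Fin 4 → Fin 2
functional 0F 0F = 0F
functional 0F 1F = 0F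
functional 0F 2F = 1F
functional 0F 3F = 1F
functional 1F 0F = 0F
functional 1F 1F = 1F
functional 1F 2F = 0F
functional 1F 3F = 1F
functional 2F 0F = 0F
functional 2F 1F = 1F
functional 2F 2F = 1F
functional 2F 3F = 0F

functional-coordinates : ∀ c c′ → c ≢ c′ → ∀ x y → Σ (Fin 4) λ k → functional c k ≡ x × functional c′ k ≡ y ×
                         (∀ k′ → functional c k′ ≡ x → functional c′ k′ ≡ y → k′ ≡ k)
functional-coordinates = toWitness {a? =
  all? λ c → all? λ c′ → ¬? (c ≟ c′) →-dec (all? λ x → all? λ y → any? λ k →
    (functional c k ≟ x) ×-dec ((functional c′ k ≟ y) ×-dec
    (all? λ k′ → (functional c k′ ≟ x) →-dec ((functional c′ k′ ≟ y) →-dec (k′ ≟ k)))))} tt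

bit-opposite : ∀ (x y : Fin 2) → x ≢ y → x ≡ opposite y
bit-opposite 0F 0F x≢y = ⊥-elim (x≢y refl)
bit-opposite 0F 1F _ = refl
bit-opposite 1F 0F _ = refl
bit-opposite 1F 1F x≢y = ⊥-elim (x≢y refl)

opposite-≢ : ∀ (x : Fin 2) → opposite x ≢ x
opposite-≢ 0F ()
opposite-≢ 1F ()

twist : Dir → Fin 2 → Fin 2
twist up x = x
twist down x = opposite x

twist-involutive : ∀ s x → twist s (twist s x) ≡ x
twist-involutive up x = refl
twist-involutive down x = opposite-involutive x

module Haggkvist (m : ℕ) .{{_ : NonZero m}} (3≤m : 3 ≤ m) where
  open Zmod m

  parity : ℕ → Bool
  parity zero = false
  parity (suc n) = not (parity n)

  bit : Bool → Fin 3
  bit false = 0F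
  bit true = 1F

  -- A proper colouring of the cycle of columns: 0 and 1 alternate, and colour 2 on the last column
  -- keeps the closing edge proper when `m` is odd.
  colourℕ : ℕ → Fin 3
  colourℕ n with suc n ℕ.≟ m
  ... | yes _ = 2F
  ... | no _ = bit (parity n)

  colourℕ-last : ∀ {n} → suc n ≡ m → colourℕ n ≡ 2F
  colourℕ-last {n} eq with suc n ℕ.≟ m
  ... | yes _ = refl
  ... | no neq = ⊥-elim (neq eq)

  colourℕ-proper : ∀ {n} → suc n < m → colourℕ n ≢ colourℕ (suc n)
  colourℕ-proper {n} lt with suc n ℕ.≟ m | suc (suc n) ℕ.≟ m
  ... | yes eq | _ = ⊥-elim (<⇒≢ lt eq)
  ... | no _ | yes _ = last≢ (parity n)
    where
    last≢ : ∀ b → bit b ≢ 2F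
    last≢ false ()
    last≢ true ()
  ... | no _ | no _ = flip≢ (parity n)
    where
    flip≢ : ∀ b → bit b ≢ bit (not b)
    flip≢ false ()
    flip≢ true ()

  colourℕ-0 : colourℕ 0 ≡ 0F
  colourℕ-0 with 1 ℕ.≟ m
  ... | yes refl = ⊥-elim (<⇒≱ 3≤m (s≤s z≤n))
  ... | no _ = refl

  colour : Fin m → Fin 3
  colour j = colourℕ (toℕ j)

  colour-proper : ∀ j → colour j ≢ colour (j ⊞ 1)
  colour-proper j with suc-cases j
  ... | inj₁ (lt , eq) = λ e → colourℕ-proper lt (trans e (cong colourℕ eq))
  ... | inj₂ (eq , eq′) = λ e → 2F≢0F (trans (sym (colourℕ-last eq)) (trans e (trans (cong colourℕ eq′) colourℕ-0)))
    where
    2F≢0F : 2F ≢ 0F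
    2F≢0F ()

  o : Fin 4 → Fin m → Fin 2
  o k j = functional (colour j) k

  -- A state names the gap about to be crossed and the direction; gap `j` lies between the columns
  -- `j` and `j ⊞ 1`.
  column : Fin m × Dir → Fin m
  column (j , up) = j
  column (j , down) = j ⊞ 1

  next-column : Fin m × Dir → Fin m
  next-column (j , up) = j ⊞ 1
  next-column (j , down) = j

  column-next : ∀ p → Step 1 (column p) (next-column p)
  column-next (j , up) = inj₁ refl
  column-next (j , down) = inj₂ refl

  +2≢ : ∀ j → j ⊞ 1 ⊞ 1 ≢ j
  +2≢ j eq = ⊞-≢ j (s≤s z≤n) 3≤m (trans (sym (⊞-⊞ j 1 1)) eq)

  -- Two states of opposite direction with the same columns would force `j ⊞ 2 ≡ j`, impossible for
  -- `m ≥ 3`.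
  columns-determine : ∀ p q → column q ≡ column p → next-column q ≡ next-column p → q ≡ p
  columns-determine (j , up) (j′ , up) e _ = cong (_, up) e
  columns-determine (j , down) (j′ , down) _ e = cong (_, down) e
  columns-determine (j , up) (j′ , down) e e′ = ⊥-elim (+2≢ j (trans (cong (_⊞ 1) (sym e′)) e))
  columns-determine (j , down) (j′ , up) e e′ = ⊥-elim (+2≢ j (trans (cong (_⊞ 1) (sym e)) e′))

  move-column : ∀ {p p′} → Move p p′ → column p′ ≡ next-column p
  move-column (rise e) = ⊞1 e
    where
    ⊞1 : ∀ {j j′ : Fin m} → toℕ j′ ≡ suc (toℕ j) → j′ ≡ j ⊞ 1
    ⊞1 {j} {j′} e with suc-cases j
    ... | inj₁ (_ , e′) = toℕ-injective (trans e (sym e′))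
    ... | inj₂ (e′ , _) = ⊥-elim (<⇒≢ (toℕ<n j′) (trans e e′))
  move-column (turn↓ e) = cong (_⊞ 1) e
  move-column (sink {j} {j′} e) with suc-cases j′
  ... | inj₁ (_ , e′) = toℕ-injective (trans e′ (sym e))
  ... | inj₂ (e′ , _) = ⊥-elim (<⇒≢ (toℕ<n j) (trans e e′))
  move-column (turn↑ e) = e

  -- Two states lie over column `j`: `(j , up)` and `(j ⊞ ⊖ 1 , down)`. The first is put on the copy
  -- `o k j` of `j` and the second on the other copy, so each `k` gives a placement of all of `F`.
  place : Fin 4 → (Fin m × Dir) ↔ (Fin m × Fin 2)
  place k = mk↔ₛ′ to from to-from from-to
    where
    to : Fin m × Dir → Fin m × Fin 2
    to p = column p , twist (proj₂ p) (o k (column p))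
    from : Fin m × Fin 2 → Fin m × Dir
    from (j , x) with x ≟ o k j
    ... | yes _ = j , up
    ... | no _ = j ⊞ ⊖ 1 , down
    to-from : ∀ v → to (from v) ≡ v
    to-from (j , x) with x ≟ o k j
    ... | yes eq = cong (j ,_) (sym eq)
    ... | no neq rewrite ⊖-⊞ j 1 = cong (j ,_) (sym (bit-opposite _ _ neq))
    from-to : ∀ p → from (to p) ≡ p
    from-to (j , up) with o k j ≟ o k j
    ... | yes _ = refl
    ... | no neq = ⊥-elim (neq refl)
    from-to (j , down) with opposite (o k (j ⊞ 1)) ≟ o k (j ⊞ 1)
    ... | yes eq = ⊥-elim (opposite-≢ _ eq)
    ... | no _ = cong (_, down) (⊞-⊖ j 1)

  module _ (F : List ℕ) (unfolded : Unfolding F m) where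
    Φ = proj₁ unfolded
    moves = proj₂ unfolded
    open Inverse

    Ω : Fin 4 → FVert F ↔ (Fin m × Fin 2)
    Ω k = place k ↔-∘ Φ

    to-Φ-Ω : ∀ k v → to (place k) (to Φ (from (Ω k) v)) ≡ v
    to-Φ-Ω k v = inverseˡ (Ω k) refl

    -- Only one vertex of `F` crosses a given gap in a given direction, so an arc over that gap lies
    -- in copy `k` exactly when `k` sends this vertex and its successor to the right copies of their
    -- columns. The two columns have different colours, so the two functionals prescribe `k`
    -- uniquely.
    cycle-factorization : Factorization F (Lift (Step 1))
    cycle-factorization =
      4 , (λ k u v → FArc F (from (Ω k) u) (from (Ω k) v)) ,
      (λ k → ↔-sym (Ω k) , λ u v → mk⇔ (λ h → h) (λ h → h)) , sub , cov
      where
      sub : ∀ k u v → FArc F (from (Ω k) u) (from (Ω k) v) → Step 1 (proj₁ u) (proj₁ v)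
      sub k u v arc = subst₂ (Step 1) (cong proj₁ (to-Φ-Ω k u))
        (trans (sym (move-column (moves _ _ arc))) (cong proj₁ (to-Φ-Ω k v))) (column-next (to Φ (from (Ω k) u)))

      cov′ : ∀ p u v → column p ≡ proj₁ u → next-column p ≡ proj₁ v →
             Σ (Fin 4) λ k → FArc F (from (Ω k) u) (from (Ω k) v) ×
               (∀ k′ → FArc F (from (Ω k′) u) (from (Ω k′) v) → k′ ≡ k)
      cov′ p (_ , x) (_ , y) refl refl = k , subst₂ (FArc F) (at-u k eq₁) (at-v k eq₂) arc , uniq
        where
        u′ v′ : FVert F
        u′ = from Φ p
        v′ = proj₁ (FArc-total F u′)
        arc : FArc F u′ v′
        arc = proj₂ (FArc-total F u′)
        Φu′ : to Φ u′ ≡ p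
        Φu′ = inverseˡ Φ refl
        q = to Φ v′
        q-column : column q ≡ next-column p
        q-column = subst (λ z → column q ≡ next-column z) Φu′ (move-column (moves u′ v′ arc))
        proper : colour (column p) ≢ colour (next-column p)
        proper with column-next p
        ... | inj₁ e rewrite e = colour-proper (column p)
        ... | inj₂ e rewrite e = λ eq → colour-proper (next-column p) (sym eq)
        -- The twists turn the required vertices `x`, `y` into required values of `o k`, according
        -- to the directions of the two states.
        sol = functional-coordinates _ _ proper (twist (proj₂ p) x) (twist (proj₂ q) y)
        k = proj₁ sol
        eq₁ = proj₁ (proj₂ sol)
        eq₂ = proj₁ (proj₂ (proj₂ sol))
        at-u : ∀ k → o k (column p) ≡ twist (proj₂ p) x → u′ ≡ from (Ω k) (column p , x)
        at-u k e = sym (inverseʳ (Ω k) (trans (cong (column p ,_)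
          (sym (trans (cong (twist (proj₂ p)) e) (twist-involutive (proj₂ p) x)))) (sym (cong (to (place k)) Φu′))))
        at-v : ∀ k → o k (next-column p) ≡ twist (proj₂ q) y → v′ ≡ from (Ω k) (next-column p , y)
        at-v k e = sym (inverseʳ (Ω k) (sym (trans
          (cong (λ c → c , twist (proj₂ q) (o k c)) q-column)
          (cong (next-column p ,_) (trans (cong (twist (proj₂ q)) e) (twist-involutive (proj₂ q) y))))))
        uniq : ∀ k′ → FArc F (from (Ω k′) (column p , x)) (from (Ω k′) (next-column p , y)) → k′ ≡ k
        uniq k′ arc′ = proj₂ (proj₂ (proj₂ sol)) k′ e₁ e₂
          where
          u″ = from (Ω k′) (column p , x)
          v″ = from (Ω k′) (next-column p , y)
          Φu″ : to Φ u″ ≡ p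
          Φu″ = columns-determine p (to Φ u″) (cong proj₁ (to-Φ-Ω k′ _))
            (trans (sym (move-column (moves _ _ arc′))) (cong proj₁ (to-Φ-Ω k′ _)))
          u″≡u′ : u″ ≡ u′
          u″≡u′ = sym (inverseʳ Φ (sym Φu″))
          v″≡v′ : v″ ≡ v′
          v″≡v′ = FArc-functional F (subst (λ z → FArc F z v″) u″≡u′ arc′) arc
          e₁ : o k′ (column p) ≡ twist (proj₂ p) x
          e₁ = trans (sym (twist-involutive (proj₂ p) _)) (cong (twist (proj₂ p))
            (trans (sym (cong (λ z → proj₂ (to (place k′) z)) Φu″)) (cong proj₂ (to-Φ-Ω k′ _))))
          e₂ : o k′ (next-column p) ≡ twist (proj₂ q) y
          e₂ = trans (sym (twist-involutive (proj₂ q) _)) (cong (twist (proj₂ q))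
            (trans (cong (λ c → twist (proj₂ q) (o k′ c)) (sym q-column))
            (trans (cong (λ z → proj₂ (to (place k′) (to Φ z))) (sym v″≡v′)) (cong proj₂ (to-Φ-Ω k′ _)))))

      cov : ∀ u v → Step 1 (proj₁ u) (proj₁ v) →
            Σ (Fin 4) λ k → FArc F (from (Ω k) u) (from (Ω k) v) ×
              (∀ k′ → FArc F (from (Ω k′) u) (from (Ω k′) v) → k′ ≡ k)
      cov u v (inj₁ e) = cov′ (proj₁ u , up) u v refl (sym e)
      cov u v (inj₂ e) = cov′ (proj₁ v , down) u v (sym e) refl

  haggkvist : ∀ {F} → All (2 ∣_) F → order F ≡ 2 * m → ∀ {E} → Hamiltonian E → Factorization F (Lift E)
  haggkvist {F} evens ord {E} (g , E⇔) with unfold F evens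
  ... | n , ord′ , unf with refl ← *-cancelˡ-≡ n m 2 (trans (sym ord′) ord) =
    factorization-cong F (λ {u} {v} → Equivalence.from (E⇔ (proj₁ u) (proj₁ v)))
                       (λ {u} {v} → Equivalence.to (E⇔ (proj₁ u) (proj₁ v)))
      (factorization-pullback F (g ×-↔ ↔-id (Fin 2)) (cycle-factorization F unf))

-- Connected 2-regular graphs

record TwoRegular {V : Set} (E : V → V → Set) : Set where
  field
    symmetric   : ∀ {x y} → E x y → E y x
    irreflexive : ∀ {x} → ¬ E x x
    neighbours  : ∀ x → Σ V λ p → Σ V λ q → p ≢ q × E x p × E x q × (∀ {y} → E x y → y ≡ p ⊎ y ≡ q)

module Walk (m : ℕ) .{{_ : NonZero m}} {E : Fin m → Fin m → Set} (R : TwoRegular E) (v₀ : Fin m) where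
  open Zmod m
  open TwoRegular R

  other : ∀ {x y} → E x y → Σ (Fin m) λ z → E x z × z ≢ y × (∀ {w} → E x w → w ≡ y ⊎ w ≡ z)
  other {x} {y} xy with neighbours x
  ... | p , q , p≢q , xp , xq , only with only xy
  ...   | inj₁ refl = q , xq , (λ e → p≢q (sym e)) , only
  ...   | inj₂ refl = p , xp , p≢q , λ xw → swap (only xw)

  -- The walk carries its current edge and not just a vertex: that is what lets it leave each vertex
  -- by the edge it did not arrive on.
  Edge : Set
  Edge = Σ (Fin m) λ x → Σ (Fin m) λ y → E x y

  advance : Edge → Edge
  advance (x , y , xy) = y , proj₁ (other (symmetric xy)) , proj₁ (proj₂ (other (symmetric xy)))

  edge : ℕ → Edge
  edge zero = v₀ , proj₁ N , proj₁ (proj₂ (proj₂ (proj₂ N)))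
    where N = neighbours v₀
  edge (suc n) = advance (edge n)

  walk : ℕ → Fin m
  walk n = proj₁ (edge n)

  walk-E : ∀ n → E (walk n) (walk (suc n))
  walk-E n = proj₂ (proj₂ (edge n))

  walk-≢ : ∀ n → walk (2 + n) ≢ walk n
  walk-≢ n = proj₁ (proj₂ (proj₂ (other (symmetric (walk-E n)))))

  walk-only : ∀ n {y} → E (walk (suc n)) y → y ≡ walk n ⊎ y ≡ walk (2 + n)
  walk-only n = proj₂ (proj₂ (proj₂ (other (symmetric (walk-E n)))))

  InjectiveBelow : ℕ → Set
  InjectiveBelow n = ∀ {i j} → i < j → j < n → walk i ≢ walk j

  Return : ℕ → Set
  Return n = InjectiveBelow n × Σ ℕ λ i → i < n × walk i ≡ walk n

  -- `k` is fuel. It cannot run out, since `suc m` vertices of the walk are not all distinct.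
  first-return : ∀ k n → k + n ≡ suc m → InjectiveBelow n → Σ ℕ Return
  first-return zero n refl inj with i , j , i<j , eq ← pigeonhole (n<1+n m) (λ i → walk (toℕ i)) =
    ⊥-elim (inj i<j (toℕ<n j) eq)
  first-return (suc k) n eq inj with any? {n} (λ i → walk (toℕ i) ≟ walk n)
  ... | yes (i , e) = n , inj , toℕ i , toℕ<n i , e
  ... | no never = first-return k (suc n) (trans (+-suc k n) eq) inj′
    where
    inj′ : InjectiveBelow (suc n)
    inj′ {i} {j} i<j j<1+n e with m≤n⇒m<n∨m≡n (≤-pred j<1+n)
    ... | inj₁ j<n = inj i<j j<n e
    ... | inj₂ refl = never (fromℕ< i<j , trans (cong walk (toℕ-fromℕ< i<j)) e)

  -- The walk never turns back, so a first repetition at a later vertex would give that vertex a third neighbour.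
  return-to-start : ∀ {n i} → InjectiveBelow n → i < n → walk i ≡ walk n → walk 0 ≡ walk n
  return-to-start {n} {zero} inj i<n e = e
  return-to-start {suc n} {suc i} inj (s≤s i<n) e
    with walk-only i (subst (λ z → E z (walk n)) (sym e) (symmetric (walk-E n)))
  ... | inj₁ e′ = ⊥-elim (inj i<n (n<1+n n) (sym e′))
  ... | inj₂ e′ with m≤n⇒m<n∨m≡n i<n
  ...   | inj₂ refl = ⊥-elim (irreflexive (subst (λ z → E (walk n) z) (sym e) (walk-E n)))
  ...   | inj₁ 1+i<n with m≤n⇒m<n∨m≡n 1+i<n
  ...     | inj₁ 2+i<n = ⊥-elim (inj 2+i<n (n<1+n n) (sym e′))
  ...     | inj₂ refl = ⊥-elim (walk-≢ (suc i) (sym e))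

  return : Σ ℕ λ n → InjectiveBelow (suc n) × walk 0 ≡ walk (suc n)
  return with first-return m 1 (+-comm m 1) (λ { {_} {zero} () _ ; {_} {suc j} _ (s≤s ()) })
  ... | suc n , inj , i , i<n , e = n , inj , return-to-start inj i<n e

  last : ℕ
  last = proj₁ return

  walk-injective : InjectiveBelow (suc last)
  walk-injective = proj₁ (proj₂ return)

  walk-return : walk 0 ≡ walk (suc last)
  walk-return = proj₂ (proj₂ return)

  1<last : 1 < last
  1<last with last in eq
  ... | 0 = ⊥-elim (irreflexive (subst (E (walk 0)) (sym (trans walk-return (cong (λ z → walk (suc z)) eq))) (walk-E 0)))
  ... | 1 = ⊥-elim (walk-≢ 0 (sym (trans walk-return (cong (λ z → walk (suc z)) eq))))
  ... | suc (suc _) = s≤s (s≤s z≤n)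

  start-only : ∀ {y} → E (walk 0) y → y ≡ walk 1 ⊎ y ≡ walk last
  start-only {y} Ey with other (walk-E 0)
  ... | z , _ , _ , only with only Ey
  ...   | inj₁ e = inj₁ e
  ...   | inj₂ e with only (subst (λ v → E v (walk last)) (sym walk-return) (symmetric (walk-E last)))
  ...     | inj₁ e′ = ⊥-elim (walk-injective 1<last (n<1+n last) (sym e′))
  ...     | inj₂ e′ = inj₂ (trans e (sym e′))

  -- By 2-regularity the neighbours along the closed walk are all the neighbours. The predecessor of
  -- index 0 is `last`.
  successor-or-predecessor : ∀ {i y} → i ≤ last → E (walk i) y →
                             (y ≡ walk (suc i)) ⊎ (Σ ℕ λ j → j ≤ last × y ≡ walk j × walk i ≡ walk (suc j))
  successor-or-predecessor {zero} _ Ey with start-only Ey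
  ... | inj₁ e = inj₁ e
  ... | inj₂ e = inj₂ (last , ≤-refl , e , walk-return)
  successor-or-predecessor {suc i} i<last Ey with walk-only i Ey
  ... | inj₁ e = inj₂ (i , <⇒≤ i<last , e , refl)
  ... | inj₂ e = inj₁ e

  Visited : Fin m → Set
  Visited y = Σ ℕ λ j → j ≤ last × y ≡ walk j

  visited-closed : ∀ {x y} → Visited x → E x y → Visited y
  visited-closed (i , i≤ , refl) Ey with successor-or-predecessor i≤ Ey
  ... | inj₂ (j , j≤ , e , _) = j , j≤ , e
  ... | inj₁ e with m≤n⇒m<n∨m≡n i≤
  ...   | inj₁ i<last = suc i , i<last , e
  ...   | inj₂ refl = 0 , z≤n , trans e (sym walk-return)

  visited-start : Visited v₀
  visited-start = 0 , z≤n , refl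

  module _ (connected : ∀ v → Star E v₀ v) where

    visited : ∀ v → Visited v
    visited v = go visited-start (connected v)
      where
      go : ∀ {x y} → Visited x → Star E x y → Visited y
      go vis ε = vis
      go vis (e ◅ es) = go (visited-closed vis e) es

    walk-injective′ : ∀ {i j} → i ≤ last → j ≤ last → walk i ≡ walk j → i ≡ j
    walk-injective′ {i} {j} i≤ j≤ e with <-cmp i j
    ... | tri< i<j _ _ = ⊥-elim (walk-injective i<j (s≤s j≤) e)
    ... | tri≈ _ i≡j _ = i≡j
    ... | tri> _ _ j<i = ⊥-elim (walk-injective j<i (s≤s i≤) (sym e))

    -- The closed walk repeats no vertex, which gives one inequality, and by connectivity it misses
    -- none, which gives the other.
    suc-last : suc last ≡ m
    suc-last = ≤-antisym
      (injective⇒≤ {f = λ (i : Fin (suc last)) → walk (toℕ i)}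
        λ {i} {j} e → toℕ-injective (walk-injective′ (≤-pred (toℕ<n i)) (≤-pred (toℕ<n j)) e))
      (injective⇒≤ {f = λ v → fromℕ< (s≤s (proj₁ (proj₂ (visited v))))}
        λ {u} {v} e → trans (proj₂ (proj₂ (visited u)))
          (trans (cong walk (trans (sym (toℕ-fromℕ< _)) (trans (cong toℕ e) (toℕ-fromℕ< _))))
                 (sym (proj₂ (proj₂ (visited v))))))

    ≤last : ∀ (i : Fin m) → toℕ i ≤ last
    ≤last i = ≤-pred (subst (toℕ i <_) (sym suc-last) (toℕ<n i))

    visited-< : ∀ v → proj₁ (visited v) < m
    visited-< v = subst (proj₁ (visited v) <_) suc-last (s≤s (proj₁ (proj₂ (visited v))))

    position : Fin m → Fin m
    position v = fromℕ< (visited-< v)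

    walk-position : ∀ v → walk (toℕ (position v)) ≡ v
    walk-position v = trans (cong walk (toℕ-fromℕ< (visited-< v))) (sym (proj₂ (proj₂ (visited v))))

    walk-Fin-injective : ∀ {i j : Fin m} → walk (toℕ i) ≡ walk (toℕ j) → i ≡ j
    walk-Fin-injective {i} {j} e = toℕ-injective (walk-injective′ (≤last i) (≤last j) e)

    walk-⊞1 : ∀ i → walk (toℕ (i ⊞ 1)) ≡ walk (suc (toℕ i))
    walk-⊞1 i with suc-cases i
    ... | inj₁ (_ , e) = cong walk e
    ... | inj₂ (e , e′) = trans (cong walk e′) (trans walk-return (cong walk (trans suc-last (sym e))))

    hamiltonian : Hamiltonian E
    hamiltonian = mk↔ₛ′ position (λ i → walk (toℕ i)) (λ i → walk-Fin-injective (walk-position (walk (toℕ i)))) walk-position ,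
      λ u v → mk⇔ (to u v) (from u v)
      where
      to : ∀ u v → E u v → Step 1 (position u) (position v)
      to u v e with successor-or-predecessor (≤last (position u)) (subst (λ z → E z v) (sym (walk-position u)) e)
      ... | inj₁ v≡ = inj₁ (walk-Fin-injective (trans (walk-position v) (trans v≡ (sym (walk-⊞1 (position u))))))
      ... | inj₂ (j , j≤ , v≡ , u≡) = inj₂ (walk-Fin-injective (trans u≡
              (trans (cong (λ z → walk (suc z)) (sym (walk-injective′ (≤last (position v)) j≤ (trans (walk-position v) v≡))))
                     (sym (walk-⊞1 (position v))))))
      to-next : ∀ u v → position v ≡ position u ⊞ 1 → E u v
      to-next u v e = subst₂ E (walk-position u)
        (trans (sym (walk-⊞1 (position u))) (trans (cong (λ z → walk (toℕ z)) (sym e)) (walk-position v)))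
        (walk-E (toℕ (position u)))
      from : ∀ u v → Step 1 (position u) (position v) → E u v
      from u v (inj₁ e) = to-next u v e
      from u v (inj₂ e) = symmetric (to-next v u e)

-- Switching along 4-cycles

mean-< : ∀ {a b n} → a + a < n → b + b < n → a + b < n
mean-< {a} {b} a+a<n b+b<n with ≤-total a b
... | inj₁ a≤b = ≤-<-trans (+-monoˡ-≤ b a≤b) b+b<n
... | inj₂ b≤a = ≤-<-trans (+-monoʳ-≤ a b≤a) a+a<n

module Switching (m : ℕ) .{{_ : NonZero m}} (P : Fin m → Set) (P? : Decidable P) where
  open Zmod m

  -- P marks the corners x of the 4-cycles x, x+a, x+a+b, x+b whose a-edges and b-edges are to trade places.
  Switched : ℕ → Fin m → Set
  Switched c x = P x ⊎ P (x ⊞ ⊖ c)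

  switched? : ∀ c → Decidable (Switched c)
  switched? c x = P? x ⊎-dec P? (x ⊞ ⊖ c)

  -- The 4-cycle is symmetric in `a` and `b`, so `Arc a b` serves for the `a`-graph after the trade
  -- and `Arc b a` for the `b`-graph. The `a`-edge leaving `u` lies on the 4-cycles with corner `u`
  -- or `u - b`, the `b`-edge on those with corner `u` or `u - a`.
  Arc : ℕ → ℕ → Fin m → Fin m → Set
  Arc a b u v = (v ≡ u ⊞ a × ¬ Switched b u) ⊎ (v ≡ u ⊞ b × Switched a u)

  Edge : ℕ → ℕ → Fin m → Fin m → Set
  Edge a b u v = Arc a b u v ⊎ Arc a b v u

  ⊞-⊖′ : ∀ {x y} d → x ≡ y ⊞ d → y ≡ x ⊞ ⊖ d
  ⊞-⊖′ {y = y} d refl = sym (⊞-⊖ y d)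

  kept : ∀ {a b x} → ¬ Switched b x → Edge a b x (x ⊞ a)
  kept ¬s = inj₁ (inj₁ (refl , ¬s))

  corner-near : ∀ {a b x} → P x → Edge a b x (x ⊞ b)
  corner-near px = inj₁ (inj₂ (refl , inj₁ px))

  corner-far : ∀ {a b x} → P x → Edge a b (x ⊞ a) (x ⊞ a ⊞ b)
  corner-far {a} {b} {x} px = inj₁ (inj₂ (refl , inj₂ (subst P (sym (⊞-⊖ x a)) px)))

  edge-step : ∀ {a b u v} → Edge a b u v → Step a u v ⊎ Step b u v
  edge-step (inj₁ (inj₁ (e , _))) = inj₁ (inj₁ e)
  edge-step (inj₁ (inj₂ (e , _))) = inj₂ (inj₁ e)
  edge-step (inj₂ (inj₁ (e , _))) = inj₁ (inj₂ e)
  edge-step (inj₂ (inj₂ (e , _))) = inj₂ (inj₂ e)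

  step-edge : ∀ {a b u v} → Step a u v → Edge a b u v ⊎ Edge b a u v
  step-edge {a} {b} {u} {v} (inj₁ e) with switched? b u
  ... | yes s = inj₂ (inj₁ (inj₂ (e , s)))
  ... | no ¬s = inj₁ (inj₁ (inj₁ (e , ¬s)))
  step-edge {a} {b} {u} {v} (inj₂ e) with switched? b v
  ... | yes s = inj₂ (inj₂ (inj₂ (e , s)))
  ... | no ¬s = inj₁ (inj₂ (inj₁ (e , ¬s)))

  -- The hypotheses make `a`, `- a`, `b`, `- b` four different nonzero residues.
  module Short {a b : ℕ} (0<a : 0 < a) (0<b : 0 < b) (a≢b : a ≢ b) (a+a<m : a + a < m) (b+b<m : b + b < m) where

    a<m : a < m
    a<m = ≤-<-trans (m≤m+n a a) a+a<m
    b<m : b < m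
    b<m = ≤-<-trans (m≤m+n b b) b+b<m

    a+b<m : a + b < m
    a+b<m = mean-< {a} a+a<m b+b<m

    ⊞a≢⊞b : ∀ x → x ⊞ a ≢ x ⊞ b
    ⊞a≢⊞b x eq = a≢b (⊞-cancel-< x a<m b<m eq)

    ⊞⊞≢ : ∀ {d e} x → 0 < d → d + e < m → x ⊞ d ⊞ e ≢ x
    ⊞⊞≢ {d} {e} x 0<d lt eq = ⊞-≢ x (≤-trans 0<d (m≤m+n d e)) lt (trans (sym (⊞-⊞ x d e)) eq)

    ⊞≢⊖ : ∀ {d e} x → 0 < d → d + e < m → x ⊞ d ≢ x ⊞ ⊖ e
    ⊞≢⊖ {d} {e} x 0<d lt eq = ⊞⊞≢ x 0<d lt (trans (cong (_⊞ e) eq) (⊖-⊞ x e))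

    arcs-disjoint : ∀ {u v} → Arc a b u v → ¬ Arc b a u v
    arcs-disjoint (inj₁ (e , _)) (inj₁ (e′ , _)) = ⊞a≢⊞b _ (trans (sym e) e′)
    arcs-disjoint (inj₁ (_ , ¬s)) (inj₂ (_ , s)) = ¬s s
    arcs-disjoint (inj₂ (_ , s)) (inj₁ (_ , ¬s)) = ¬s s
    arcs-disjoint (inj₂ (e , _)) (inj₂ (e′ , _)) = ⊞a≢⊞b _ (trans (sym e′) e)

    arc-step : ∀ {u v} → Arc a b u v ⊎ Arc b a u v → v ≡ u ⊞ a ⊎ v ≡ u ⊞ b
    arc-step (inj₁ (inj₁ (e , _))) = inj₁ e
    arc-step (inj₁ (inj₂ (e , _))) = inj₂ e
    arc-step (inj₂ (inj₁ (e , _))) = inj₂ e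
    arc-step (inj₂ (inj₂ (e , _))) = inj₁ e

    steps-oriented : ∀ {u v} → v ≡ u ⊞ a ⊎ v ≡ u ⊞ b → ¬ (u ≡ v ⊞ a ⊎ u ≡ v ⊞ b)
    steps-oriented {u} (inj₁ refl) (inj₁ e) = ⊞⊞≢ u 0<a a+a<m (sym e)
    steps-oriented {u} (inj₁ refl) (inj₂ e) = ⊞⊞≢ u 0<a a+b<m (sym e)
    steps-oriented {u} (inj₂ refl) (inj₁ e) = ⊞⊞≢ u 0<b (subst (_< m) (+-comm a b) a+b<m) (sym e)
    steps-oriented {u} (inj₂ refl) (inj₂ e) = ⊞⊞≢ u 0<b b+b<m (sym e)

    edges-disjoint : ∀ {u v} → Edge a b u v → ¬ Edge b a u v
    edges-disjoint (inj₁ x) (inj₁ y) = arcs-disjoint x y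
    edges-disjoint (inj₂ x) (inj₂ y) = arcs-disjoint x y
    edges-disjoint (inj₁ x) (inj₂ y) = steps-oriented (arc-step (inj₁ x)) (arc-step (inj₂ y))
    edges-disjoint (inj₂ x) (inj₁ y) = steps-oriented (arc-step (inj₂ y)) (arc-step (inj₁ x))

    -- Different 4-cycles share an edge exactly when their corners differ by `a` or `b`, so the
    -- switched ones are edge-disjoint and each trade keeps all degrees.
    module _ (P-a : ∀ {x} → P x → ¬ P (x ⊞ a)) (P-b : ∀ {x} → P x → ¬ P (x ⊞ b)) where

      P-⊖a : ∀ {x} → P x → ¬ P (x ⊞ ⊖ a)
      P-⊖a {x} px p = P-a p (subst P (sym (⊖-⊞ x a)) px)
      P-⊖b : ∀ {x} → P x → ¬ P (x ⊞ ⊖ b)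
      P-⊖b {x} px p = P-b p (subst P (sym (⊖-⊞ x b)) px)

      -- The neighbour replacing the forward a-neighbour of x, and the one replacing the backward a-neighbour.
      Forward Backward : Fin m → Fin m → Set
      Forward x y = (y ≡ x ⊞ a × ¬ Switched b x) ⊎ (y ≡ x ⊞ b × P x) ⊎ (y ≡ x ⊞ ⊖ b × P (x ⊞ ⊖ b))
      Backward x y = (y ≡ x ⊞ ⊖ a × ¬ Switched b (x ⊞ ⊖ a)) ⊎ (y ≡ x ⊞ b × P (x ⊞ ⊖ a)) ⊎
                     (y ≡ x ⊞ ⊖ b × P (x ⊞ ⊖ a ⊞ ⊖ b))

      forward : ∀ x → Σ (Fin m) (Forward x)
      forward x with P? x | P? (x ⊞ ⊖ b)
      ... | yes p | _ = _ , inj₂ (inj₁ (refl , p))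
      ... | no _ | yes q = _ , inj₂ (inj₂ (refl , q))
      ... | no ¬p | no ¬q = _ , inj₁ (refl , λ { (inj₁ p) → ¬p p ; (inj₂ q) → ¬q q })

      backward : ∀ x → Σ (Fin m) (Backward x)
      backward x with P? (x ⊞ ⊖ a) | P? (x ⊞ ⊖ a ⊞ ⊖ b)
      ... | yes p | _ = _ , inj₂ (inj₁ (refl , p))
      ... | no _ | yes q = _ , inj₂ (inj₂ (refl , q))
      ... | no ¬p | no ¬q = _ , inj₁ (refl , λ { (inj₁ p) → ¬p p ; (inj₂ q) → ¬q q })

      forward-unique : ∀ {x y z} → Forward x y → Forward x z → y ≡ z
      forward-unique (inj₁ (e , _)) (inj₁ (e′ , _)) = trans e (sym e′)
      forward-unique (inj₂ (inj₁ (e , _))) (inj₂ (inj₁ (e′ , _))) = trans e (sym e′)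
      forward-unique (inj₂ (inj₂ (e , _))) (inj₂ (inj₂ (e′ , _))) = trans e (sym e′)
      forward-unique (inj₁ (_ , ¬s)) (inj₂ (inj₁ (_ , p))) = ⊥-elim (¬s (inj₁ p))
      forward-unique (inj₁ (_ , ¬s)) (inj₂ (inj₂ (_ , p))) = ⊥-elim (¬s (inj₂ p))
      forward-unique (inj₂ (inj₁ (_ , p))) (inj₁ (_ , ¬s)) = ⊥-elim (¬s (inj₁ p))
      forward-unique (inj₂ (inj₂ (_ , p))) (inj₁ (_ , ¬s)) = ⊥-elim (¬s (inj₂ p))
      forward-unique (inj₂ (inj₁ (_ , p))) (inj₂ (inj₂ (_ , q))) = ⊥-elim (P-⊖b p q)
      forward-unique (inj₂ (inj₂ (_ , q))) (inj₂ (inj₁ (_ , p))) = ⊥-elim (P-⊖b p q)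

      backward-unique : ∀ {x y z} → Backward x y → Backward x z → y ≡ z
      backward-unique (inj₁ (e , _)) (inj₁ (e′ , _)) = trans e (sym e′)
      backward-unique (inj₂ (inj₁ (e , _))) (inj₂ (inj₁ (e′ , _))) = trans e (sym e′)
      backward-unique (inj₂ (inj₂ (e , _))) (inj₂ (inj₂ (e′ , _))) = trans e (sym e′)
      backward-unique (inj₁ (_ , ¬s)) (inj₂ (inj₁ (_ , p))) = ⊥-elim (¬s (inj₁ p))
      backward-unique (inj₁ (_ , ¬s)) (inj₂ (inj₂ (_ , p))) = ⊥-elim (¬s (inj₂ p))
      backward-unique (inj₂ (inj₁ (_ , p))) (inj₁ (_ , ¬s)) = ⊥-elim (¬s (inj₁ p))
      backward-unique (inj₂ (inj₂ (_ , p))) (inj₁ (_ , ¬s)) = ⊥-elim (¬s (inj₂ p))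
      backward-unique (inj₂ (inj₁ (_ , p))) (inj₂ (inj₂ (_ , q))) = ⊥-elim (P-⊖b p q)
      backward-unique (inj₂ (inj₂ (_ , q))) (inj₂ (inj₁ (_ , p))) = ⊥-elim (P-⊖b p q)

      b+a<m : b + a < m
      b+a<m = subst (_< m) (+-comm a b) a+b<m

      forward≢backward : ∀ {x y} → Forward x y → ¬ Backward x y
      forward≢backward (inj₁ (e , _)) (inj₁ (e′ , _)) = ⊞≢⊖ _ 0<a a+a<m (trans (sym e) e′)
      forward≢backward (inj₁ (e , _)) (inj₂ (inj₁ (e′ , _))) = ⊞a≢⊞b _ (trans (sym e) e′)
      forward≢backward (inj₁ (e , _)) (inj₂ (inj₂ (e′ , _))) = ⊞≢⊖ _ 0<a a+b<m (trans (sym e) e′)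
      forward≢backward (inj₂ (inj₁ (e , _))) (inj₁ (e′ , _)) = ⊞≢⊖ _ 0<b b+a<m (trans (sym e) e′)
      forward≢backward (inj₂ (inj₁ (_ , p))) (inj₂ (inj₁ (_ , p′))) = P-⊖a p p′
      forward≢backward (inj₂ (inj₁ (e , _))) (inj₂ (inj₂ (e′ , _))) = ⊞≢⊖ _ 0<b b+b<m (trans (sym e) e′)
      -- The coincidence `x - b ≡ x - a`, seen from `x - a - b`, reads `+ a ≡ + b`.
      forward≢backward {x} (inj₂ (inj₂ (e , _))) (inj₁ (e′ , _)) = ⊞a≢⊞b (x ⊞ ⊖ a ⊞ ⊖ b) (trans
        (trans (trans (cong (_⊞ a) (⊞-comm x (⊖ a) (⊖ b))) (⊖-⊞ (x ⊞ ⊖ b) a)) (trans (sym e) e′))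
        (sym (⊖-⊞ (x ⊞ ⊖ a) b)))
      forward≢backward (inj₂ (inj₂ (e , _))) (inj₂ (inj₁ (e′ , _))) = ⊞≢⊖ _ 0<b b+b<m (trans (sym e′) e)
      forward≢backward {x} (inj₂ (inj₂ (_ , p))) (inj₂ (inj₂ (_ , p′))) =
        P-⊖a p (subst P (⊞-comm x (⊖ a) (⊖ b)) p′)

      edge⇒ : ∀ {x y} → Edge a b x y → Forward x y ⊎ Backward x y
      edge⇒ (inj₁ (inj₁ (e , ¬s))) = inj₁ (inj₁ (e , ¬s))
      edge⇒ (inj₁ (inj₂ (e , inj₁ p))) = inj₁ (inj₂ (inj₁ (e , p)))
      edge⇒ (inj₁ (inj₂ (e , inj₂ p))) = inj₂ (inj₂ (inj₁ (e , p)))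
      edge⇒ (inj₂ (inj₁ (e , ¬s))) with refl ← ⊞-⊖′ a e = inj₂ (inj₁ (refl , ¬s))
      edge⇒ (inj₂ (inj₂ (e , inj₁ p))) with refl ← ⊞-⊖′ b e = inj₁ (inj₂ (inj₂ (refl , p)))
      edge⇒ {x} (inj₂ (inj₂ (e , inj₂ p))) with refl ← ⊞-⊖′ b e =
        inj₂ (inj₂ (inj₂ (refl , subst P (⊞-comm x (⊖ b) (⊖ a)) p)))

      forward-edge : ∀ {x y} → Forward x y → Edge a b x y
      forward-edge (inj₁ (e , ¬s)) = inj₁ (inj₁ (e , ¬s))
      forward-edge (inj₂ (inj₁ (e , p))) = inj₁ (inj₂ (e , inj₁ p))
      forward-edge {x} (inj₂ (inj₂ (refl , p))) = inj₂ (inj₂ (sym (⊖-⊞ x b) , inj₁ p))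

      backward-edge : ∀ {x y} → Backward x y → Edge a b x y
      backward-edge {x} (inj₁ (refl , ¬s)) = inj₂ (inj₁ (sym (⊖-⊞ x a) , ¬s))
      backward-edge (inj₂ (inj₁ (e , p))) = inj₁ (inj₂ (e , inj₂ p))
      backward-edge {x} (inj₂ (inj₂ (refl , p))) =
        inj₂ (inj₂ (sym (⊖-⊞ x b) , inj₂ (subst P (⊞-comm x (⊖ a) (⊖ b)) p)))

      edge-irreflexive : ∀ {x} → ¬ Edge a b x x
      edge-irreflexive {x} e with edge-step e
      ... | inj₁ s = ⊞-≢ x 0<a a<m (sym (Sum.reduce s))
      ... | inj₂ s = ⊞-≢ x 0<b b<m (sym (Sum.reduce s))

      two-regular : TwoRegular (Edge a b)
      two-regular = record
        { symmetric = swap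
        ; irreflexive = edge-irreflexive
        ; neighbours = λ x → let p , f = forward x ; q , g = backward x in
            p , q , (λ e → forward≢backward f (subst (Backward x) (sym e) g)) , forward-edge f , backward-edge g ,
            λ e → Sum.map (λ f′ → forward-unique f′ f) (λ g′ → backward-unique g′ g) (edge⇒ e)
        }

-- Connectivity of the switched graphs

module Paths {V : Set} {_~_ : V → V → Set} (isEquivalence : IsEquivalence _~_) where
  private module E = IsEquivalence isEquivalence

  path : (f : ℕ → V) → ∀ {p q} → p ≤ q → (∀ {j} → p ≤ j → j < q → f j ~ f (suc j)) → f p ~ f q
  path f {p} {q} p≤q steps with m≤n⇒m<n∨m≡n p≤q
  ... | inj₂ refl = E.refl
  path f {p} {suc q} p≤q steps | inj₁ (s≤s p≤q′) =
    E.trans (path f p≤q′ (λ p≤j j<q → steps p≤j (m<n⇒m<1+n j<q))) (steps p≤q′ ≤-refl)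

  -- Rows are the closed `a`-cycles of length `N`. Switch `i` cuts the rows `i` and `suc i` between
  -- the columns `c i` and `suc (c i)` and joins them by two rungs there; `c-moves` keeps the two
  -- cuts of an inner row apart.
  module Rows (ν : ℕ → ℕ → V) (r N : ℕ) (c : ℕ → ℕ)
    (wrap  : ∀ i → ν i N ≡ ν i 0)
    (uncut : ∀ {i j} → i ≤ r → j < N → (i < r → j ≢ c i) → (∀ {i′} → i ≡ suc i′ → j ≢ c i′) → ν i j ~ ν i (suc j))
    (rungˡ : ∀ {i} → i < r → ν i (c i) ~ ν (suc i) (c i))
    (rungʳ : ∀ {i} → i < r → ν i (suc (c i)) ~ ν (suc i) (suc (c i)))
    (c<N   : ∀ {i} → i < r → suc (c i) < N)
    (c-moves : ∀ {i} → suc i < r → c (suc i) ≢ c i)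
    where

    -- A closed row cut at two places x ≠ y falls into two arcs, each with an end at x or x + 1.
    reach-cut : ∀ {i x y} → (∀ {j} → j < N → j ≢ x → j ≢ y → ν i j ~ ν i (suc j)) →
                x ≢ y → suc x ≤ N → y ≤ N → ∀ {j} → j < N → ν i j ~ ν i x ⊎ ν i j ~ ν i (suc x)
    reach-cut {i} {x} {y} step x≢y x<N y≤N {j} j<N with <-cmp x y
    ... | tri≈ _ x≡y _ = ⊥-elim (x≢y x≡y)
    ... | tri< x<y _ _ with <-≤-connex x j | <-≤-connex y j
    ...   | inj₂ j≤x | _ = inj₁ (path (ν i) j≤x λ _ k<x →
              step (<-trans k<x x<N) (<⇒≢ k<x) (<⇒≢ (<-trans k<x x<y)))
    ...   | inj₁ x<j | inj₂ j≤y = inj₂ (E.sym (path (ν i) x<j λ x<k k<j →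
              step (<-trans k<j j<N) (λ e → <⇒≢ x<k (sym e)) (<⇒≢ (<-≤-trans k<j j≤y))))
    ...   | inj₁ x<j | inj₁ y<j = inj₁ (E.trans
              (path (ν i) (<⇒≤ j<N) λ j≤k k<N →
                step k<N (λ e → <⇒≢ (<-≤-trans x<j j≤k) (sym e)) (λ e → <⇒≢ (<-≤-trans y<j j≤k) (sym e)))
              (subst (_~ ν i x) (sym (wrap i)) (path (ν i) z≤n λ _ k<x →
                step (<-trans k<x x<N) (<⇒≢ k<x) (<⇒≢ (<-trans k<x x<y)))))
    reach-cut {i} {x} {y} step x≢y x<N y≤N {j} j<N | tri> _ _ y<x with <-≤-connex y j | <-≤-connex x j
    ... | _ | inj₁ x<j = inj₂ (E.sym (path (ν i) x<j λ x<k k<j →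
            step (<-trans k<j j<N) (λ e → <⇒≢ x<k (sym e)) (λ e → <⇒≢ (<-trans y<x x<k) (sym e))))
    ... | inj₁ y<j | inj₂ j≤x = inj₁ (path (ν i) j≤x λ j≤k k<x →
            step (<-trans k<x x<N) (<⇒≢ k<x) (λ e → <⇒≢ (<-≤-trans y<j j≤k) (sym e)))
    ... | inj₂ j≤y | inj₂ _ = inj₂ (E.trans
            (E.sym (path (ν i) z≤n λ _ k<j →
              step (<-trans k<j j<N) (<⇒≢ (<-trans (<-≤-trans k<j j≤y) y<x)) (<⇒≢ (<-≤-trans k<j j≤y))))
            (E.sym (subst (ν i (suc x) ~_) (wrap i) (path (ν i) x<N λ x<k k<N →
              step k<N (λ e → <⇒≢ x<k (sym e)) (λ e → <⇒≢ (<-trans y<x x<k) (sym e))))))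

    -- Row 0 has only one cut; y = N then stands for an absent second one.
    previous-cut : ∀ i → i < r → Σ ℕ λ y → c i ≢ y × y ≤ N × (∀ {j} → j < N → j ≢ y → ∀ {i′} → i ≡ suc i′ → j ≢ c i′)
    previous-cut zero 0<r = N , (λ e → <⇒≢ (<-trans (n<1+n _) (c<N 0<r)) e) , ≤-refl , λ _ _ ()
    previous-cut (suc i) i<r = c i , c-moves i<r , <⇒≤ (<-trans (n<1+n _) (c<N (<-trans (n<1+n i) i<r))) ,
      λ { _ j≢ refl → j≢ }

    climb : ∀ {i j} → i < r → j < N → Σ ℕ λ j′ → j′ < N × ν i j ~ ν (suc i) j′
    climb {i} i<r j<N with previous-cut i i<r
    ... | y , x≢y , y≤N , avoid with reach-cut {i} {c i} {y}
            (λ j<N j≢x j≢y → uncut (<⇒≤ i<r) j<N (λ _ → j≢x) (avoid j<N j≢y)) x≢y (<⇒≤ (c<N i<r)) y≤N j<N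
    ...   | inj₁ p = c i , <-trans (n<1+n _) (c<N i<r) , E.trans p (rungˡ i<r)
    ...   | inj₂ p = suc (c i) , c<N i<r , E.trans p (rungʳ i<r)

    -- Only the last switch cuts this row, and a cycle without one edge is still connected: column 0
    -- is reached directly from below the cut and through `N` from above it.
    top-row : ∀ {r′ j} → r ≡ suc r′ → j < N → ν r j ~ ν r 0
    top-row {r′} {j} r≡ j<N with <-≤-connex (c r′) j
    ... | inj₂ j≤c = E.sym (path (ν r) z≤n λ _ k<j → uncut ≤-refl (<-trans k<j j<N)
            (λ lt → ⊥-elim (<-irrefl refl lt)) λ e q → <⇒≢ (<-≤-trans k<j j≤c) (trans q (cong c (suc-injective (trans (sym e) r≡)))))
    ... | inj₁ c<j = subst (ν r j ~_) (wrap r) (path (ν r) (<⇒≤ j<N) λ j≤k k<N → uncut ≤-refl k<N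
            (λ lt → ⊥-elim (<-irrefl refl lt)) λ e q → <⇒≢ (<-≤-trans c<j j≤k) (sym (trans q (cong c (suc-injective (trans (sym e) r≡))))))

    rows-connected : 0 < r → ∀ k {i j} → k + i ≡ r → j < N → ν i j ~ ν r 0
    rows-connected 0<r zero refl j<N = top-row (sym (m+[n∸m]≡n 0<r)) j<N
    rows-connected 0<r (suc k) {i} eq j<N with climb (m+n≤o⇒n≤o k (≤-reflexive (trans (+-suc k i) eq))) j<N
    ... | j′ , j′<N , p = E.trans p (rows-connected 0<r k (trans (+-suc k i) eq) j′<N)

-- The zigzag of switches and its effect on the `b`-cycles

double : ℕ → ℕ
double zero = 0
double (suc h) = suc (suc (double h))

halve : ∀ i → Σ ℕ λ h → i ≡ double h ⊎ i ≡ suc (double h)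
halve zero = 0 , inj₁ refl
halve (suc i) with halve i
... | h , inj₁ refl = h , inj₂ refl
... | h , inj₂ refl = suc h , inj₁ refl

double-cancel-≤ : ∀ {h k} → double h ≤ suc (double k) → h ≤ k
double-cancel-≤ {zero} _ = z≤n
double-cancel-≤ {suc h} {zero} (s≤s ())
double-cancel-≤ {suc h} {suc k} (s≤s (s≤s p)) = s≤s (double-cancel-≤ p)

double-mono-≤ : ∀ {h k} → h ≤ k → double h ≤ double k
double-mono-≤ z≤n = z≤n
double-mono-≤ (s≤s p) = s≤s (s≤s (double-mono-≤ p))

zig : ℕ → ℕ
zig zero = 0
zig (suc zero) = 1
zig (suc (suc n)) = zig n

zig-even : ∀ h → zig (double h) ≡ 0
zig-even zero = refl
zig-even (suc h) = zig-even h

zig-odd : ∀ h → zig (suc (double h)) ≡ 1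
zig-odd zero = refl
zig-odd (suc h) = zig-odd h

zig≤1 : ∀ i → zig i ≤ 1
zig≤1 zero = z≤n
zig≤1 (suc zero) = ≤-refl
zig≤1 (suc (suc i)) = zig≤1 i

zig-moves : ∀ i → zig (suc i) ≢ zig i
zig-moves zero ()
zig-moves (suc zero) ()
zig-moves (suc (suc i)) = zig-moves i

module _ {V : Set} {_~_ : V → V → Set} (isEquivalence : IsEquivalence _~_) where
  private module E = IsEquivalence isEquivalence
  open Paths isEquivalence

  -- Alternating switches between columns 0, 1 and columns 1, 2 on the levels 0, …, L-1 act like one such pair:
  -- a cap below, a cup on top, and a single thread winding from column 2 below to column 0 on top.
  module Snake (ν : ℕ → ℕ → V) (h₀ : ℕ)
    (near : ∀ {i} → i < double (suc h₀) → ν i (zig i) ~ ν i (suc (zig i)))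
    (far  : ∀ {i} → i < double (suc h₀) → ν (suc i) (zig i) ~ ν (suc i) (suc (zig i)))
    (col0 : ∀ {h} → h ≤ h₀ → ν (suc (double h)) 0 ~ ν (suc (suc (double h))) 0)
    (col2 : ∀ {h} → h ≤ h₀ → ν (double h) 2 ~ ν (suc (double h)) 2)
    where

    L : ℕ
    L = double (suc h₀)

    even< : ∀ {h} → h ≤ h₀ → double h < L
    even< p = m<n⇒m<1+n (s≤s (double-mono-≤ p))

    odd< : ∀ {h} → h ≤ h₀ → suc (double h) < L
    odd< p = s≤s (s≤s (double-mono-≤ p))

    even-near : ∀ {h} → h ≤ h₀ → ν (double h) 0 ~ ν (double h) 1
    even-near {h} p = subst (λ z → ν (double h) z ~ ν (double h) (suc z)) (zig-even h) (near (even< p))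

    even-far : ∀ {h} → h ≤ h₀ → ν (suc (double h)) 0 ~ ν (suc (double h)) 1
    even-far {h} p = subst (λ z → ν (suc (double h)) z ~ ν (suc (double h)) (suc z)) (zig-even h) (far (even< p))

    odd-near : ∀ {h} → h ≤ h₀ → ν (suc (double h)) 1 ~ ν (suc (double h)) 2
    odd-near {h} p = subst (λ z → ν (suc (double h)) z ~ ν (suc (double h)) (suc z)) (zig-odd h) (near (odd< p))

    odd-far : ∀ {h} → h ≤ h₀ → ν (double (suc h)) 1 ~ ν (double (suc h)) 2
    odd-far {h} p = subst (λ z → ν (double (suc h)) z ~ ν (double (suc h)) (suc z)) (zig-odd h) (far (odd< p))

    -- One period of the thread takes two levels: up column 2 to an odd row, across to column 0, up
    -- to the next even row, and across back to column 2.
    thread : ∀ {h} → h ≤ h₀ → ν (double h) 2 ~ ν 0 2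
    odd-row : ∀ {h} → h ≤ h₀ → ∀ {j} → j ≤ 2 → ν (suc (double h)) j ~ ν 0 2
    even-row : ∀ {h} → suc h ≤ h₀ → ∀ {j} → j ≤ 2 → ν (double (suc h)) j ~ ν 0 2

    thread {zero} p = E.refl
    thread {suc h} p = even-row p ≤-refl

    odd-row {h} p z≤n = E.trans (even-far p) (E.trans (odd-near p) (E.trans (E.sym (col2 p)) (thread p)))
    odd-row {h} p (s≤s z≤n) = E.trans (odd-near p) (E.trans (E.sym (col2 p)) (thread p))
    odd-row {h} p (s≤s (s≤s z≤n)) = E.trans (E.sym (col2 p)) (thread p)

    even-row {h} p z≤n = E.trans (E.sym (col0 (<⇒≤ p))) (odd-row (<⇒≤ p) z≤n)
    even-row {h} p (s≤s z≤n) = E.trans (E.sym (even-near p)) (even-row p z≤n)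
    even-row {h} p (s≤s (s≤s z≤n)) = E.trans (E.sym (odd-far (<⇒≤ p))) (even-row p (s≤s z≤n))

    through : ν L 0 ~ ν 0 2
    through = E.trans (E.sym (col0 ≤-refl)) (odd-row ≤-refl z≤n)

    cap : ν 0 0 ~ ν 0 1
    cap = even-near z≤n

    cup : ν L 1 ~ ν L 2
    cup = odd-far ≤-refl

    inner : ∀ {i j} → 0 < i → i < L → j ≤ 2 → ν i j ~ ν 0 2
    inner {i} 0<i i<L j≤2 with halve i
    ... | h , inj₂ refl = odd-row (double-cancel-≤ (<⇒≤ (≤-pred i<L))) j≤2
    ... | suc h , inj₁ refl = even-row (double-cancel-≤ (≤-pred i<L)) j≤2

  module Columns (ν : ℕ → ℕ → V) (h₀ g M : ℕ) (c : ℕ → ℕ)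
    (c-zig  : ∀ {i} → i < double (suc h₀) → c i ≡ zig i)
    (c-diag : ∀ k → c (double (suc h₀) + k) ≡ 2 + k)
    (r<M    : double (suc h₀) + g < M)
    (wrap   : ∀ j → ν M j ≡ ν 0 j)
    (near   : ∀ {i} → i < double (suc h₀) + g → ν i (c i) ~ ν i (suc (c i)))
    (far    : ∀ {i} → i < double (suc h₀) + g → ν (suc i) (c i) ~ ν (suc i) (suc (c i)))
    (uncut  : ∀ {i j} → i < M → j < 3 + g → (i < double (suc h₀) + g → j ≢ c i × j ≢ suc (c i)) → ν i j ~ ν (suc i) j)
    where

    L : ℕ
    L = double (suc h₀)

    L≤M : L ≤ M
    L≤M = ≤-trans (m≤m+n L g) (<⇒≤ r<M)

    <L⇒<r : ∀ {i} → i < L → i < L + g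
    <L⇒<r i<L = <-≤-trans i<L (m≤m+n L g)

    c-cases : ∀ i → (i < L × c i ≡ zig i) ⊎ (Σ ℕ λ k → i ≡ L + k × c i ≡ 2 + k)
    c-cases i with <-≤-connex i L
    ... | inj₁ i<L = inj₁ (i<L , c-zig i<L)
    ... | inj₂ L≤i = inj₂ (i ∸ L , sym (m+[n∸m]≡n L≤i) , trans (cong c (sym (m+[n∸m]≡n L≤i))) (c-diag (i ∸ L)))

    -- In the columns j ≥ 3 the switches cut just the edges leaving the rows L+j-3 and L+j-2 (the latter if j < 2+g);
    -- from row L on they cut column 2 only at row L (if 0 < g).
    uncut-high : ∀ {i k} → i < M → k ≤ g → L ≤ i ⊎ 0 < k → (i < L + g → i ≢ L + k) → suc i ≢ L + k → ν i (2 + k) ~ ν (suc i) (2 + k)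
    uncut-high {i} {k} i<M k≤g out here prev = uncut i<M (s≤s (s≤s (s≤s k≤g))) lem
      where
      lem : i < L + g → 2 + k ≢ c i × 2 + k ≢ suc (c i)
      lem i<r with c-cases i
      ... | inj₂ (k′ , refl , e) = (λ q → here i<r (cong (L +_) (suc-injective (suc-injective (trans (sym e) (sym q)))))) ,
                (λ q → prev (trans (sym (+-suc L k′)) (cong (L +_) (suc-injective (suc-injective (trans (sym (cong suc e)) (sym q)))))))
      ... | inj₁ (i<L , e) = (λ q → <⇒≱ (s≤s (s≤s z≤n)) (≤-trans (≤-reflexive (trans q e)) (zig≤1 i))) , lem₂ out
        where
        lem₂ : L ≤ i ⊎ 0 < k → 2 + k ≢ suc (c i)
        lem₂ (inj₁ L≤i) = ⊥-elim (<⇒≱ i<L L≤i)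
        lem₂ (inj₂ 0<k) q = <⇒≱ (s≤s 0<k) (≤-trans (≤-reflexive (suc-injective (trans q (cong suc e)))) (zig≤1 i))

    to-bottom : ∀ {i k} → i ≤ M → k ≤ g → suc (L + k) ≤ i → ν i (2 + k) ~ ν 0 (2 + k)
    to-bottom {i} {k} i≤M k≤g lt = subst (ν i (2 + k) ~_) (wrap (2 + k))
      (path (λ z → ν z (2 + k)) i≤M λ i≤l l<M → uncut-high l<M k≤g (inj₁ (≤-trans (m≤m+n L k) (<⇒≤ (≤-trans lt i≤l))))
        (λ _ e → <⇒≢ (≤-trans lt i≤l) (sym e)) (λ e → <⇒≢ (m<n⇒m<1+n (≤-trans lt i≤l)) (sym e)))

    from-bottom : ∀ {i k} → suc k ≤ g → i ≤ L + k → ν i (3 + k) ~ ν 0 (3 + k)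
    from-bottom {i} {k} k<g le = E.sym (path (λ z → ν z (3 + k)) z≤n λ _ l<i →
      let l<L+k = <-≤-trans l<i le in
      uncut-high (<-trans l<L+k (<-trans (+-monoʳ-< L k<g) r<M)) k<g (inj₂ (s≤s z≤n))
        (λ _ e → <⇒≢ (<-trans l<L+k (n<1+n _)) (trans e (+-suc L k)))
        (λ e → <⇒≢ (s≤s l<L+k) (trans e (+-suc L k))))

    diag-near : ∀ {k} → k < g → ν (L + k) (2 + k) ~ ν (L + k) (3 + k)
    diag-near {k} k<g = subst (λ z → ν (L + k) z ~ ν (L + k) (suc z)) (c-diag k) (near (+-monoʳ-< L k<g))

    diag-far : ∀ {k} → k < g → ν (suc (L + k)) (2 + k) ~ ν (suc (L + k)) (3 + k)
    diag-far {k} k<g = subst (λ z → ν (suc (L + k)) z ~ ν (suc (L + k)) (suc z)) (c-diag k) (far (+-monoʳ-< L k<g))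

    -- The columns to the right restore each edge cut in column 2+k.
    restored : ∀ n {k} → n + k ≡ g → ν (L + k) (2 + k) ~ ν (suc (L + k)) (2 + k)
    restored zero {k} refl = uncut-high r<M ≤-refl (inj₁ (m≤m+n L k)) (λ lt → ⊥-elim (<-irrefl refl lt))
      (λ e → <⇒≢ (n<1+n (L + k)) (sym e))
    restored (suc n) {k} eq = E.trans (diag-near k<g) (E.trans around (E.sym (diag-far k<g)))
      where
      k<g : k < g
      k<g = m+n≤o⇒n≤o n (≤-reflexive (trans (+-suc n k) eq))
      -- Column `3 + k` is followed from row `L + k` down to row 0, which is row `M`, and on down to
      -- row `L + k + 2`. The edge from there to row `L + k + 1` is cut if `suc k < g`, and the
      -- induction supplies its replacement.
      around : ν (L + k) (3 + k) ~ ν (suc (L + k)) (3 + k)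
      around = E.trans (from-bottom k<g ≤-refl) (E.sym (E.trans
        (subst (λ z → ν z (3 + k) ~ ν (suc z) (3 + k)) (+-suc L k) (restored n (trans (+-suc n k) eq)))
        (to-bottom (≤-trans (s≤s (+-monoʳ-< L k<g)) r<M) k<g (≤-reflexive (cong suc (+-suc L k))))))

    restored′ : ∀ {k} → k ≤ g → ν (L + k) (2 + k) ~ ν (suc (L + k)) (2 + k)
    restored′ {k} k≤g = restored (g ∸ k) (m∸n+n≡m k≤g)

    centre-bottom : ∀ {k} → k ≤ g → ν (L + k) (2 + k) ~ ν 0 (2 + k)
    centre-bottom k≤g = E.trans (restored′ k≤g) (to-bottom (≤-trans (s≤s (+-monoʳ-≤ L k≤g)) r<M) k≤g ≤-refl)

    uncut-low : ∀ {i j} → j ≤ 1 → L ≤ i → i < M → ν i j ~ ν (suc i) j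
    uncut-low {i} {j} j≤1 L≤i i<M = uncut i<M (s≤s (≤-trans j≤1 (s≤s z≤n))) lem
      where
      lem : i < L + g → j ≢ c i × j ≢ suc (c i)
      lem _ with c-cases i
      ... | inj₁ (i<L , _) = ⊥-elim (<⇒≱ i<L L≤i)
      ... | inj₂ (k , refl , e) = (λ q → <⇒≱ (s≤s (s≤s z≤n)) (≤-trans (≤-reflexive (trans (sym e) (sym q))) j≤1)) ,
                                  (λ q → <⇒≱ (s≤s (s≤s z≤n)) (≤-trans (≤-reflexive (trans (sym (cong suc e)) (sym q))) j≤1))

    low-bottom : ∀ {i j} → j ≤ 1 → L ≤ i → i ≤ M → ν i j ~ ν 0 j
    low-bottom {i} {j} j≤1 L≤i i≤M = subst (ν i j ~_) (wrap j)
      (path (λ z → ν z j) i≤M λ i≤l l<M → uncut-low j≤1 (≤-trans L≤i i≤l) l<M)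

    near-zig : ∀ {i} → i < L → ν i (zig i) ~ ν i (suc (zig i))
    near-zig {i} i<L = subst (λ z → ν i z ~ ν i (suc z)) (c-zig i<L) (near (<L⇒<r i<L))

    far-zig : ∀ {i} → i < L → ν (suc i) (zig i) ~ ν (suc i) (suc (zig i))
    far-zig {i} i<L = subst (λ z → ν (suc i) z ~ ν (suc i) (suc z)) (c-zig i<L) (far (<L⇒<r i<L))

    column-0 : ∀ {h} → h ≤ h₀ → ν (suc (double h)) 0 ~ ν (suc (suc (double h))) 0
    column-0 {h} h≤h₀ = uncut (<-≤-trans lt L≤M) (s≤s z≤n) λ _ → (λ q → 0≢1+n (trans q e)) , λ ()
      where
      lt = s≤s (s≤s (double-mono-≤ h≤h₀))
      e = trans (c-zig lt) (zig-odd h)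

    column-2 : ∀ {h} → h ≤ h₀ → ν (double h) 2 ~ ν (suc (double h)) 2
    column-2 {h} h≤h₀ = uncut (<-≤-trans lt L≤M) (s≤s (s≤s (s≤s z≤n))) λ _ →
        (λ q → 1+n≢0 (trans q e)) , (λ q → 1+n≢0 (suc-injective (trans q (cong suc e))))
      where
      lt = m<n⇒m<1+n (s≤s (double-mono-≤ h≤h₀))
      e = trans (c-zig lt) (zig-even h)

    open Snake ν h₀ near-zig far-zig column-0 column-2 using (cap; cup; through; inner)

    1~0 : ν 0 1 ~ ν 0 0
    1~0 = E.sym cap

    -- The thread ends in column 0 on row `L`; from there column 0 is intact up to row `M`, which is
    -- row 0 again.
    2~0 : ν 0 2 ~ ν 0 0
    2~0 = E.trans (E.sym through) (low-bottom z≤n ≤-refl L≤M)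

    -- Switch `L + k` hangs column `3 + k` onto column `2 + k`.
    high~0 : ∀ k → k ≤ g → ν 0 (2 + k) ~ ν 0 0
    high~0 zero _ = 2~0
    high~0 (suc k) k<g = E.trans (E.sym (from-bottom k<g ≤-refl))
      (E.trans (E.sym (diag-near k<g)) (E.trans (centre-bottom (<⇒≤ k<g)) (high~0 k (<⇒≤ k<g))))

    column-bottom : ∀ {i j} → i < M → j < 3 + g → ν i j ~ ν 0 0
    column-bottom {i} {j} i<M j<e with <-≤-connex i L | j
    ... | inj₂ L≤i | 0 = low-bottom z≤n L≤i (<⇒≤ i<M)
    ... | inj₂ L≤i | 1 = E.trans (low-bottom ≤-refl L≤i (<⇒≤ i<M)) 1~0
    column-bottom {zero} _ _ | inj₁ _ | 0 = E.refl
    column-bottom {zero} _ _ | inj₁ _ | 1 = 1~0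
    column-bottom {suc i} _ _ | inj₁ i<L | 0 = E.trans (inner (s≤s z≤n) i<L z≤n) 2~0
    column-bottom {suc i} _ _ | inj₁ i<L | 1 = E.trans (inner (s≤s z≤n) i<L (s≤s z≤n)) 2~0
    column-bottom {zero} _ _ | inj₁ _ | 2 = 2~0
    column-bottom {suc i} _ _ | inj₁ i<L | 2 = E.trans (inner (s≤s z≤n) i<L ≤-refl) 2~0
    column-bottom {i} _ (s≤s (s≤s (s≤s k<g))) | inj₁ i<L | suc (suc (suc k)) =
      E.trans (from-bottom k<g (≤-trans (<⇒≤ i<L) (m≤m+n L k))) (high~0 (suc k) k<g)
    -- The cuts of this column lie next to row `L + k`: rows above it reach the bottom through `M`,
    -- rows below it directly, and row `L + k` itself along the restored edge.
    column-bottom {i} i<M (s≤s (s≤s (s≤s k≤g))) | inj₂ L≤i | suc (suc k) with <-cmp i (L + k)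
    ... | tri≈ _ refl _ = E.trans (centre-bottom k≤g) (high~0 k k≤g)
    ... | tri> _ _ gt = E.trans (to-bottom (<⇒≤ i<M) k≤g gt) (high~0 k k≤g)
    column-bottom {i} i<M (s≤s (s≤s (s≤s k≤g))) | inj₂ L≤i | 2 | tri< lt _ _ =
      ⊥-elim (<⇒≱ lt (subst (_≤ i) (sym (+-identityʳ L)) L≤i))
    column-bottom {i} i<M (s≤s (s≤s (s≤s k≤g))) | inj₂ L≤i | suc (suc (suc k)) | tri< lt _ _ =
      E.trans (from-bottom k≤g (≤-pred (subst (suc i ≤_) (+-suc L k) lt))) (high~0 (suc k) k≤g)

  -- Here all columns lie on one cycle of length n, column j starting at position j t.
  module SingleColumn (π : ℕ → V) (h₀ t n : ℕ)
    (r<t  : double (suc h₀) < t)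
    (2t+r<n : double (suc h₀) + 2 * t < n)
    (wrap : π n ≡ π 0)
    (near : ∀ {i} → i < double (suc h₀) → π (i + zig i * t) ~ π (i + suc (zig i) * t))
    (far  : ∀ {i} → i < double (suc h₀) → π (suc i + zig i * t) ~ π (suc i + suc (zig i) * t))
    (uncut : ∀ {p} → p < n → (∀ {i} → i < double (suc h₀) → p ≢ i + zig i * t × p ≢ i + suc (zig i) * t) → π p ~ π (suc p))
    where

    ν : ℕ → ℕ → V
    ν i j = π (i + j * t)

    L : ℕ
    L = double (suc h₀)

    0<t : 0 < t
    0<t = ≤-<-trans z≤n r<t

    -- Uniqueness of remainder and quotient modulo `t`. As `L < t`, it keeps the three strips of
    -- switched positions apart.
    coordinates : ∀ {i j i′ j′} → i < t → i′ < t → i + j * t ≡ i′ + j′ * t → i ≡ i′ × j ≡ j′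
    coordinates {i} {zero} {i′} {zero} _ _ e = trans (sym (+-identityʳ i)) (trans e (+-identityʳ i′)) , refl
    coordinates {i} {zero} {i′} {suc j′} i<t _ e =
      ⊥-elim (<⇒≱ i<t (≤-trans (≤-trans (m≤m+n t (j′ * t)) (m≤n+m _ i′)) (≤-reflexive (trans (sym e) (+-identityʳ i)))))
    coordinates {i} {suc j} {i′} {zero} _ i′<t e =
      ⊥-elim (<⇒≱ i′<t (≤-trans (≤-trans (m≤m+n t (j * t)) (m≤n+m _ i)) (≤-reflexive (trans e (+-identityʳ i′)))))
    coordinates {i} {suc j} {i′} {suc j′} i<t i′<t e =
      let e₁ , e₂ = coordinates {i} {j} {i′} {j′} i<t i′<t (+-cancelˡ-≡ t _ _ (trans (shift i j) (trans e (sym (shift i′ j′)))))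
      in e₁ , cong suc e₂
      where
      shift : ∀ i j → t + (i + j * t) ≡ i + (t + j * t)
      shift i j = trans (sym (+-assoc t i _)) (trans (cong (_+ j * t) (+-comm t i)) (+-assoc i t _))

    uncut-at : ∀ {i j} → i < t → i + j * t < n → (i < L → j ≢ zig i × j ≢ suc (zig i)) → ν i j ~ ν (suc i) j
    uncut-at {i} {j} i<t p<n free = uncut p<n λ {i′} i′<L →
      (λ e → let e₁ , e₂ = coordinates {i} {j} {i′} i<t (<-trans i′<L r<t) e in
        proj₁ (free (subst (_< L) (sym e₁) i′<L)) (trans e₂ (cong zig (sym e₁)))) ,
      (λ e → let e₁ , e₂ = coordinates {i} {j} {i′} i<t (<-trans i′<L r<t) e in
        proj₂ (free (subst (_< L) (sym e₁) i′<L)) (trans e₂ (cong (λ z → suc (zig z)) (sym e₁))))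

    <n : ∀ {i j} → i ≤ L → j ≤ 2 → i + j * t < n
    <n {i} {j} i≤L j≤2 = ≤-<-trans (+-mono-≤ i≤L (*-monoˡ-≤ t j≤2)) 2t+r<n

    column-0 : ∀ {h} → h ≤ h₀ → ν (suc (double h)) 0 ~ ν (suc (suc (double h))) 0
    column-0 {h} h≤h₀ = uncut-at {j = 0} (<-trans lt r<t) (<n {j = 0} (<⇒≤ lt) z≤n) λ _ →
        (λ q → 0≢1+n (trans q (zig-odd h))) , λ ()
      where
      lt = s≤s (s≤s (double-mono-≤ h≤h₀))

    column-2 : ∀ {h} → h ≤ h₀ → ν (double h) 2 ~ ν (suc (double h)) 2
    column-2 {h} h≤h₀ = uncut-at {j = 2} (<-trans lt r<t) (<n {j = 2} (<⇒≤ lt) ≤-refl) λ _ →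
        (λ q → 1+n≢0 (trans q (zig-even h))) , (λ q → 1+n≢0 (suc-injective (trans q (cong suc (zig-even h)))))
      where
      lt = m<n⇒m<1+n (s≤s (double-mono-≤ h≤h₀))

    open Snake ν h₀ near far column-0 column-2 using (cap; cup; through; inner)

    climb : ∀ {i j} → L ≤ i → i ≤ t → t + j * t ≤ n → ν i j ~ ν 0 (suc j)
    climb {i} {j} L≤i i≤t le = path (λ z → ν z j) i≤t λ i≤l l<t →
      uncut-at {j = j} l<t (<-≤-trans (+-monoˡ-< (j * t) l<t) le) λ l<L → ⊥-elim (<⇒≱ l<L (≤-trans L≤i i≤l))

    -- All cut edges leave positions below `L + 2 * t`, so the rest of the cycle runs intact to `n`
    -- and closes up at 0.
    last-stretch : ∀ {p} → L + 2 * t ≤ p → p ≤ n → π p ~ ν 0 0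
    last-stretch {p} le p≤n = subst (π p ~_) wrap (path π p≤n λ {l} p≤l l<n → uncut l<n λ {i} i<L →
      (λ e → <⇒≢ (<-≤-trans (+-mono-<-≤ i<L (*-monoˡ-≤ t {zig i} {2} (≤-trans (zig≤1 i) (s≤s z≤n)))) (≤-trans le p≤l)) (sym e)) ,
      (λ e → <⇒≢ (<-≤-trans (+-mono-<-≤ i<L (*-monoˡ-≤ t {suc (zig i)} (s≤s (zig≤1 i)))) (≤-trans le p≤l)) (sym e)))

    2t≤n : t + 1 * t ≤ n
    2t≤n = <⇒≤ (<n {0} {2} z≤n ≤-refl)

    t≤n : t + 0 * t ≤ n
    t≤n = <⇒≤ (<n {0} {1} z≤n (s≤s z≤n))

    1~0 : ν 0 1 ~ ν 0 0
    1~0 = E.sym cap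

    -- The thread leads to position `L`, the intact stretch after it to position `t`, where column 1
    -- starts, and the cap from there to position 0.
    2~0 : ν 0 2 ~ ν 0 0
    2~0 = E.trans (E.sym through) (E.trans (climb {j = 0} ≤-refl (<⇒≤ r<t) t≤n) 1~0)

    strip : ∀ {i j} → i < L → j ≤ 2 → ν i j ~ ν 0 0
    strip {zero} {0} _ _ = E.refl
    strip {zero} {1} _ _ = 1~0
    strip {zero} {2} _ _ = 2~0
    strip {zero} {suc (suc (suc _))} _ (s≤s (s≤s ()))
    strip {suc i} i<L j≤2 = E.trans (inner (s≤s z≤n) i<L j≤2) 2~0

    0~ : ∀ {j} → j ≤ 1 → ν 0 (suc j) ~ ν 0 0
    0~ z≤n = 1~0
    0~ (s≤s z≤n) = 2~0

    below : ∀ {i j} → i < t → j ≤ 1 → t + j * t ≤ n → ν i j ~ ν 0 0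
    below {i} {j} i<t j≤1 le with <-≤-connex i L
    ... | inj₁ i<L = strip i<L (≤-trans j≤1 (s≤s z≤n))
    ... | inj₂ L≤i = E.trans (climb {j = j} L≤i (<⇒≤ i<t) le) (0~ j≤1)

    column-bottom : ∀ {p} → p < n → π p ~ π 0
    column-bottom {p} p<n with <-≤-connex p (1 * t)
    ... | inj₁ p<t = subst (λ z → π z ~ π 0) (+-identityʳ p)
                       (below {p} {0} (subst (p <_) (+-identityʳ t) p<t) z≤n t≤n)
    ... | inj₂ t≤p with <-≤-connex p (2 * t)
    ...   | inj₁ p<2t = subst (λ z → π z ~ π 0) (m∸n+n≡m t≤p)
                          (below {p ∸ 1 * t} {1} (+-cancelʳ-< (1 * t) _ _ (subst (_< 2 * t) (sym (m∸n+n≡m t≤p)) p<2t)) ≤-refl 2t≤n)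
    ...   | inj₂ 2t≤p with <-≤-connex p (L + 2 * t)
    ...     | inj₂ le = last-stretch le (<⇒≤ p<n)
    ...     | inj₁ lt = subst (λ z → π z ~ π 0) (m∸n+n≡m 2t≤p)
                          (strip {p ∸ 2 * t} {2} (+-cancelʳ-< (2 * t) _ _ (subst (_< L + 2 * t) (sym (m∸n+n≡m 2t≤p)) lt)) ≤-refl)

star-isEquivalence : ∀ {V : Set} {E : V → V → Set} → (∀ {x y} → E x y → E y x) → IsEquivalence (Star E)
star-isEquivalence sym = record { refl = ε ; sym = reverse sym ; trans = _◅◅_ }

-- The switched graphs of two differences in Z_m

module Corners (m : ℕ) .{{_ : NonZero m}} (v₀ : Fin m) (a b r : ℕ) (c : ℕ → ℕ) where
  open Zmod m

  ν : ℕ → ℕ → Fin m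
  ν i j = v₀ ⊞ (i * b + j * a)

  ν-a : ∀ i j → ν i j ⊞ a ≡ ν i (suc j)
  ν-a i j = trans (⊞-⊞ v₀ _ a) (cong (v₀ ⊞_) (trans (+-assoc (i * b) (j * a) a) (cong (i * b +_) (+-comm (j * a) a))))

  ν-b : ∀ i j → ν i j ⊞ b ≡ ν (suc i) j
  ν-b i j = trans (⊞-⊞ v₀ _ b) (cong (v₀ ⊞_) (trans (+-comm _ b) (sym (+-assoc b (i * b) (j * a)))))

  Corner : Fin m → Set
  Corner x = Σ (Fin r) λ i → x ≡ ν (toℕ i) (c (toℕ i))

  corner? : Decidable Corner
  corner? x = any? λ i → x ≟ ν (toℕ i) (c (toℕ i))

  open Switching m Corner corner? public

  corner : ∀ {i} → i < r → Corner (ν i (c i))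
  corner {i} i<r = fromℕ< i<r , cong (λ z → ν z (c z)) (sym (toℕ-fromℕ< i<r))

  rungˡ : ∀ {i} → i < r → Edge a b (ν i (c i)) (ν (suc i) (c i))
  rungˡ {i} i<r = subst (Edge a b _) (ν-b i (c i)) (corner-near (corner i<r))

  rungʳ : ∀ {i} → i < r → Edge a b (ν i (suc (c i))) (ν (suc i) (suc (c i)))
  rungʳ {i} i<r = subst₂ (Edge a b) (ν-a i (c i)) (trans (cong (_⊞ b) (ν-a i (c i))) (ν-b i (suc (c i))))
    (corner-far (corner i<r))

  near : ∀ {i} → i < r → Edge b a (ν i (c i)) (ν i (suc (c i)))
  near {i} i<r = subst (Edge b a _) (ν-a i (c i)) (corner-near (corner i<r))

  far : ∀ {i} → i < r → Edge b a (ν (suc i) (c i)) (ν (suc i) (suc (c i)))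
  far {i} i<r = subst₂ (Edge b a) (ν-b i (c i)) (trans (cong (_⊞ a) (ν-b i (c i))) (ν-a (suc i) (c i)))
    (corner-far (corner i<r))

  ⊖-move : ∀ {x y} d → x ⊞ ⊖ d ≡ y → x ≡ y ⊞ d
  ⊖-move {x} d refl = sym (⊖-⊞ x d)

  switched-a : ∀ {x} → Switched a x → Σ ℕ λ i → i < r × (x ≡ ν i (c i) ⊎ x ≡ ν i (suc (c i)))
  switched-a (inj₁ (i , e)) = toℕ i , toℕ<n i , inj₁ e
  switched-a (inj₂ (i , e)) = toℕ i , toℕ<n i , inj₂ (trans (⊖-move a e) (ν-a (toℕ i) (c (toℕ i))))

  switched-b : ∀ {x} → Switched b x → Σ ℕ λ i → i < r × (x ≡ ν i (c i) ⊎ x ≡ ν (suc i) (c i))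
  switched-b (inj₁ (i , e)) = toℕ i , toℕ<n i , inj₁ e
  switched-b (inj₂ (i , e)) = toℕ i , toℕ<n i , inj₂ (trans (⊖-move b e) (ν-b (toℕ i) (c (toℕ i))))

  kept-a : ∀ {i j} → ¬ Switched b (ν i j) → Edge a b (ν i j) (ν i (suc j))
  kept-a {i} {j} ¬s = subst (Edge a b _) (ν-a i j) (kept ¬s)

  kept-b : ∀ {i j} → ¬ Switched a (ν i j) → Edge b a (ν i j) (ν (suc i) j)
  kept-b {i} {j} ¬s = subst (Edge b a _) (ν-b i j) (kept ¬s)

  module RowCoordinates (N : ℕ) (0<r : 0 < r)
    (wrap : ∀ i → ν i N ≡ ν i 0)
    (ν-injective : ∀ {i j i′ j′} → i < suc r → i′ < suc r → j < N → j′ < N → ν i j ≡ ν i′ j′ → i ≡ i′ × j ≡ j′)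
    (ν-surjective : ∀ v → Σ ℕ λ i → Σ ℕ λ j → i < suc r × j < N × ν i j ≡ v)
    (c<N : ∀ {i} → i < r → suc (c i) < N)
    (c-moves : ∀ {i} → suc i < r → c (suc i) ≢ c i)
    where

    c<N′ : ∀ {i} → i < r → c i < N
    c<N′ i<r = <-trans (n<1+n _) (c<N i<r)

    -- Adding `a` stays in the row, and a row carries at most one corner.
    corner-a : ∀ {x} → Corner x → ¬ Corner (x ⊞ a)
    corner-a (i , refl) (i′ , e) with ν-injective {toℕ i} {suc (c (toℕ i))} {toℕ i′} {c (toℕ i′)} (m<n⇒m<1+n (toℕ<n i)) (m<n⇒m<1+n (toℕ<n i′)) (c<N (toℕ<n i)) (c<N′ (toℕ<n i′))
                                        (trans (sym (ν-a (toℕ i) (c (toℕ i)))) e)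
    ... | e₁ , e₂ = <⇒≢ (n<1+n _) (trans (cong c e₁) (sym e₂))

    -- Adding `b` stays in the column, while the corner of the next row lies in another one.
    corner-b : ∀ {x} → Corner x → ¬ Corner (x ⊞ b)
    corner-b (i , refl) (i′ , e) with ν-injective {suc (toℕ i)} {c (toℕ i)} {toℕ i′} {c (toℕ i′)} (s≤s (toℕ<n i)) (m<n⇒m<1+n (toℕ<n i′)) (c<N′ (toℕ<n i)) (c<N′ (toℕ<n i′))
                                        (trans (sym (ν-b (toℕ i) (c (toℕ i)))) e)
    ... | e₁ , e₂ = c-moves (subst (_< r) (sym e₁) (toℕ<n i′)) (trans (cong c e₁) (sym e₂))

    ~-isEquivalence : IsEquivalence (Star (Edge a b))
    ~-isEquivalence = star-isEquivalence swap

    row-uncut : ∀ {i j} → i ≤ r → j < N → (i < r → j ≢ c i) → (∀ {i′} → i ≡ suc i′ → j ≢ c i′) →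
                ¬ Switched b (ν i j)
    row-uncut {i} {j} i≤r j<N here prev s with switched-b s
    ... | i′ , i′<r , inj₁ e with ν-injective {i} {j} {i′} {c i′} (s≤s i≤r) (m<n⇒m<1+n i′<r) j<N (c<N′ i′<r) e
    ...   | refl , e₂ = here i′<r e₂
    row-uncut {i} {j} i≤r j<N here prev s | i′ , i′<r , inj₂ e with ν-injective {i} {j} {suc i′} {c i′} (s≤s i≤r) (s≤s i′<r) j<N (c<N′ i′<r) e
    ...   | e₁ , e₂ = prev e₁ e₂

    row-step : ∀ {i j} → i ≤ r → j < N → (i < r → j ≢ c i) → (∀ {i′} → i ≡ suc i′ → j ≢ c i′) →
               Star (Edge a b) (ν i j) (ν i (suc j))
    row-step {i} {j} i≤r j<N here prev = kept-a {i} {j} (row-uncut i≤r j<N here prev) ◅ ε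

    left-rung : ∀ {i} → i < r → Star (Edge a b) (ν i (c i)) (ν (suc i) (c i))
    left-rung i<r = rungˡ i<r ◅ ε

    right-rung : ∀ {i} → i < r → Star (Edge a b) (ν i (suc (c i))) (ν (suc i) (suc (c i)))
    right-rung i<r = rungʳ i<r ◅ ε

    open Paths.Rows ~-isEquivalence ν r N c wrap row-step left-rung right-rung c<N c-moves using (rows-connected)

    a-connected : ∀ v → Star (Edge a b) (ν r 0) v
    a-connected v with ν-surjective v
    ... | i , j , s≤s i≤r , j<N , refl = reverse swap (rows-connected 0<r (r ∸ i) (m∸n+n≡m i≤r) j<N)

    module _ (0<a : 0 < a) (0<b : 0 < b) (a≢b : a ≢ b) (a+a<m : a + a < m) (b+b<m : b + b < m)
             (u₀ : Fin m) (b-connected : ∀ v → Star (Edge b a) u₀ v) where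

      hamiltonian-a : Hamiltonian (Edge a b)
      hamiltonian-a = Walk.hamiltonian m (Short.two-regular 0<a 0<b a≢b a+a<m b+b<m corner-a corner-b) (ν r 0) a-connected

      hamiltonian-b : Hamiltonian (Edge b a)
      hamiltonian-b = Walk.hamiltonian m
        (Short.two-regular 0<b 0<a (λ e → a≢b (sym e)) b+b<m a+a<m corner-b corner-a) u₀ b-connected

-- Columns visited by the switches: 0, 1, 0, 1, … on the first L levels, then 2, 3, ….
zigzag : ℕ → ℕ → ℕ
zigzag L i with i <? L
... | yes _ = zig i
... | no _ = 2 + (i ∸ L)

zigzag-< : ∀ {L i} → i < L → zigzag L i ≡ zig i
zigzag-< {L} {i} i<L with i <? L
... | yes _ = refl
... | no i≮L = ⊥-elim (i≮L i<L)

zigzag-+ : ∀ L k → zigzag L (L + k) ≡ 2 + k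
zigzag-+ L k with L + k <? L
... | yes lt = ⊥-elim (<⇒≱ lt (m≤m+n L k))
... | no _ = cong (2 +_) (m+n∸m≡n L k)

zigzag-bound : ∀ {L g i} → i < L + g → suc (zigzag L i) < 3 + g
zigzag-bound {L} {g} {i} lt with i <? L
... | yes _ = s≤s (s≤s (≤-trans (zig≤1 i) (s≤s z≤n)))
... | no i≮L = s≤s (s≤s (s≤s (≤-trans (≤-reflexive (sym (+-∸-assoc 1 (≮⇒≥ i≮L))))
                 (≤-trans (∸-monoˡ-≤ L lt) (≤-reflexive (m+n∸m≡n L g))))))

zigzag-moves : ∀ L i → zigzag L (suc i) ≢ zigzag L i
zigzag-moves L i with suc i <? L | i <? L
... | yes _ | yes _ = zig-moves i
... | yes lt | no i≮L = ⊥-elim (i≮L (<-trans (n<1+n i) lt))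
... | no _ | yes _ = λ e → <⇒≱ (s≤s (s≤s z≤n)) (≤-trans (≤-reflexive e) (zig≤1 i))
... | no _ | no i≮L = λ e → <⇒≢ (n<1+n (i ∸ L))
        (trans (sym (suc-injective (suc-injective e))) (+-∸-assoc 1 (≮⇒≥ i≮L)))

-- Coordinates and units in Z_m

injective⇒surjective : ∀ {n} (f : Fin n → Fin n) → (∀ {i j} → f i ≡ f j → i ≡ j) → ∀ v → Σ (Fin n) λ i → f i ≡ v
injective⇒surjective {suc n} f inj v with any? (λ i → f i ≟ v)
... | yes hit = hit
... | no miss = ⊥-elim (1+n≰n (injective⇒≤ {f = λ i → punchOut {i = v} {f i} (λ e → miss (i , sym e))}
                  λ {i} {j} e → inj (punchOut-injective (λ e → miss (i , sym e)) (λ e → miss (j , sym e)) e)))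

%-≡⇒∣ : ∀ {x y} d .{{_ : NonZero d}} → x % d ≡ y % d → d ∣ y ∸ x
%-≡⇒∣ {x} {y} d e = divides (y / d ∸ x / d) (begin
  y ∸ x                                        ≡⟨ cong₂ _∸_ (m≡m%n+[m/n]*n y d) (m≡m%n+[m/n]*n x d) ⟩
  (y % d + y / d * d) ∸ (x % d + x / d * d)    ≡⟨ cong (λ z → (y % d + y / d * d) ∸ (z + x / d * d)) e ⟩
  (y % d + y / d * d) ∸ (y % d + x / d * d)    ≡⟨ [m+n]∸[m+o]≡n∸o (y % d) _ _ ⟩
  y / d * d ∸ x / d * d                        ≡⟨ *-distribʳ-∸ d (y / d) (x / d) ⟨
  (y / d ∸ x / d) * d                          ∎)
  where open ≡-Reasoning

∣⇒%-≡ : ∀ {x y} d .{{_ : NonZero d}} → x ≤ y → d ∣ y ∸ x → x % d ≡ y % d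
∣⇒%-≡ {x} {y} d x≤y d∣ = trans (sym (%-remove-+ʳ x d∣)) (cong (_% d) (m+[n∸m]≡n x≤y))

%-*-cancelʳ : ∀ {b d} .{{_ : NonZero d}} → Coprime b d → ∀ x y → (x * b) % d ≡ (y * b) % d → x % d ≡ y % d
%-*-cancelʳ {b} {d} cop x y e with ≤-total x y
... | inj₁ x≤y = ∣⇒%-≡ d x≤y (coprime-divisor {d} {b} (coprime-sym cop)
        (subst (d ∣_) (trans (sym (*-distribʳ-∸ b y x)) (*-comm (y ∸ x) b)) (%-≡⇒∣ {x * b} d e)))
... | inj₂ y≤x = sym (∣⇒%-≡ d y≤x (coprime-divisor {d} {b} (coprime-sym cop)
        (subst (d ∣_) (trans (sym (*-distribʳ-∸ b x y)) (*-comm (x ∸ y) b)) (%-≡⇒∣ {y * b} d (sym e)))))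

module Coordinates (m : ℕ) .{{_ : NonZero m}} (v₀ : Fin m) (a b d N q : ℕ)
  (m≡N*d : m ≡ N * d) (a≡q*d : a ≡ q * d) (cop-q : Coprime q N) (cop-b : Coprime b d) where
  open Zmod m

  ν : ℕ → ℕ → Fin m
  ν i j = v₀ ⊞ (i * b + j * a)

  instance
    d≢0 : NonZero d
    d≢0 = m*n≢0⇒n≢0 N {{subst NonZero m≡N*d (>-nonZero (n≢0⇒n>0 (≢-nonZero⁻¹ m)))}}
    N≢0 : NonZero N
    N≢0 = m*n≢0⇒m≢0 N {{subst NonZero m≡N*d (>-nonZero (n≢0⇒n>0 (≢-nonZero⁻¹ m)))}}

  ν-wrap : ∀ i → ν i N ≡ ν i 0
  ν-wrap i = trans (cong (v₀ ⊞_) (+-comm (i * b) (N * a))) (trans (sym (⊞-⊞ v₀ _ _))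
    (trans (cong (λ z → v₀ ⊞ z ⊞ i * b) lem) (cong₂ _⊞_ (⊞-multiple v₀ q) (sym (+-identityʳ (i * b))))))
    where
    lem : N * a ≡ q * m
    lem = begin
      N * a        ≡⟨ cong (N *_) a≡q*d ⟩
      N * (q * d)  ≡⟨ *-assoc N q d ⟨
      N * q * d    ≡⟨ cong (_* d) (*-comm N q) ⟩
      q * N * d    ≡⟨ *-assoc q N d ⟩
      q * (N * d)  ≡⟨ cong (q *_) m≡N*d ⟨
      q * m        ∎
      where open ≡-Reasoning

  -- Modulo `d` the multiples of `a` vanish and `b` is a unit, which determines `i`. Dividing what
  -- remains by `d` leaves `j * q` modulo `N`, where `q` is a unit.
  ν-injective : ∀ {i j i′ j′} → i < d → i′ < d → j < N → j′ < N → ν i j ≡ ν i′ j′ → i ≡ i′ × j ≡ j′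
  ν-injective {i} {j} {i′} {j′} i<d i′<d j<N j′<N e = i≡i′ , j≡j′
    where
    e% : (i * b + j * a) % m ≡ (i′ * b + j′ * a) % m
    e% = ⊞-cancel v₀ e
    d∣m : d ∣ m
    d∣m = divides N m≡N*d
    drop-a : ∀ x j → (x + j * a) % m % d ≡ x % d
    drop-a x j = trans (m∣n⇒o%n%m≡o%m d m (x + j * a) d∣m) (%-remove-+ʳ x (∣n⇒∣m*n j (divides q a≡q*d)))
    i≡i′ : i ≡ i′
    i≡i′ = trans (sym (m<n⇒m%n≡m i<d)) (trans (%-*-cancelʳ {b} cop-b i i′
      (trans (sym (drop-a (i * b) j)) (trans (cong (_% d) e%) (drop-a (i′ * b) j′)))) (m<n⇒m%n≡m i′<d))
    e′ : v₀ ⊞ (i * b) ⊞ (j * a) ≡ v₀ ⊞ (i * b) ⊞ (j′ * a)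
    e′ = trans (⊞-⊞ v₀ _ _) (trans e (trans (cong (λ z → ν z j′) (sym i≡i′)) (sym (⊞-⊞ v₀ _ _))))
    ja : ∀ j → (j * a) % m ≡ (j * q) % N * d
    ja j = trans (%-congˡ {o = m} (trans (cong (j *_) a≡q*d) (sym (*-assoc j q d)))) (trans
      (%-congʳ {m = m} {n = N * d} {o = j * q * d} {{_}} {{N*d≢0}} m≡N*d) (sym (m%n*o≡m*o%[n*o] (j * q) N d {{_}} {{N*d≢0}})))
      where
      N*d≢0 : NonZero (N * d)
      N*d≢0 = m*n≢0 N d
    j≡j′ : j ≡ j′
    j≡j′ = trans (sym (m<n⇒m%n≡m j<N)) (trans (%-*-cancelʳ {q} cop-q j j′
      (*-cancelʳ-≡ _ _ d (trans (sym (ja j)) (trans (⊞-cancel (v₀ ⊞ (i * b)) e′) (ja j′))))) (m<n⇒m%n≡m j′<N))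

  -- The grid has `N * d ≡ m` points, so injectivity suffices.
  ν-surjective : ∀ v → Σ ℕ λ i → Σ ℕ λ j → i < d × j < N × ν i j ≡ v
  ν-surjective v = let x , fx = cast-surjective m≡N*d f f-injective in
    toℕ (row x) , toℕ (col x) , toℕ<n (row x) , toℕ<n (col x) , fx
    where
    row : Fin (N * d) → Fin d
    row x = proj₂ (remQuot {N} d x)
    col : Fin (N * d) → Fin N
    col x = proj₁ (remQuot {N} d x)
    f : Fin (N * d) → Fin m
    f x = ν (toℕ (row x)) (toℕ (col x))
    f-injective : ∀ {x y} → f x ≡ f y → x ≡ y
    f-injective {x} {y} e with ν-injective {toℕ (row x)} {toℕ (col x)} {toℕ (row y)} {toℕ (col y)}
                                 (toℕ<n (row x)) (toℕ<n (row y)) (toℕ<n (col x)) (toℕ<n (col y)) e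
    ... | e₁ , e₂ = trans (sym (combine-remQuot {N} d x))
          (trans (cong₂ combine (toℕ-injective e₂) (toℕ-injective e₁)) (combine-remQuot {N} d y))
    cast-surjective : ∀ {n} → m ≡ n → (f : Fin n → Fin m) → (∀ {x y} → f x ≡ f y → x ≡ y) → Σ (Fin n) λ x → f x ≡ v
    cast-surjective refl f inj = injective⇒surjective f inj v

module Scaling (m : ℕ) .{{_ : NonZero m}} where
  open Zmod m

  origin : Fin m
  origin = fromℕ< (n≢0⇒n>0 (≢-nonZero⁻¹ m))

  toℕ-origin-⊞ : ∀ d → toℕ (origin ⊞ d) ≡ d % m
  toℕ-origin-⊞ d = trans (toℕ-⊞ origin d) (cong (λ z → (z + d) % m) (toℕ-fromℕ< _))

  scale : ℕ → Fin m → Fin m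
  scale β i = origin ⊞ (toℕ i * β)

  *-%ˡ : ∀ x β → ((x % m) * β) % m ≡ (x * β) % m
  *-%ˡ x β = trans (%-distribˡ-* (x % m) β m) (trans (cong (λ z → (z * (β % m)) % m) (m%n%n≡m%n x m)) (sym (%-distribˡ-* x β m)))

  scale-⊞ : ∀ β i d → scale β (i ⊞ d) ≡ scale β i ⊞ (d * β)
  scale-⊞ β i d = trans (⊞-cong-% origin (begin
      (toℕ (i ⊞ d) * β) % m        ≡⟨ cong (λ z → (z * β) % m) (toℕ-⊞ i d) ⟩
      ((toℕ i + d) % m * β) % m    ≡⟨ *-%ˡ (toℕ i + d) β ⟩
      ((toℕ i + d) * β) % m        ≡⟨ cong (_% m) (*-distribʳ-+ β (toℕ i) d) ⟩
      (toℕ i * β + d * β) % m      ∎))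
    (sym (⊞-⊞ origin _ _))
    where open ≡-Reasoning

  scale-scale : ∀ β b → (β * b) % m ≡ 1 % m → ∀ i → scale b (scale β i) ≡ i
  scale-scale β b inverse i = toℕ-injective (begin
    toℕ (scale b (scale β i))              ≡⟨ toℕ-origin-⊞ _ ⟩
    (toℕ (scale β i) * b) % m              ≡⟨ cong (λ z → (z * b) % m) (toℕ-origin-⊞ _) ⟩
    ((toℕ i * β) % m * b) % m              ≡⟨ *-%ˡ (toℕ i * β) b ⟩
    (toℕ i * β * b) % m                    ≡⟨ cong (_% m) (trans (*-assoc (toℕ i) β b) (*-comm (toℕ i) _)) ⟩
    (β * b * toℕ i) % m                    ≡⟨ *-%ˡ (β * b) (toℕ i) ⟨
    ((β * b) % m * toℕ i) % m              ≡⟨ cong (λ z → (z * toℕ i) % m) inverse ⟩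
    (1 % m * toℕ i) % m                    ≡⟨ *-%ˡ 1 (toℕ i) ⟩
    (1 * toℕ i) % m                        ≡⟨ cong (_% m) (*-identityˡ (toℕ i)) ⟩
    toℕ i % m                              ≡⟨ m<n⇒m%n≡m (toℕ<n i) ⟩
    toℕ i                                  ∎)
    where open ≡-Reasoning

  inverse : ∀ {b} → Coprime b m → Σ ℕ λ β → (b * β) % m ≡ 1 % m
  inverse {b} cop with coprime-Bézout cop
  ... | Bézout.+- x y eq = x , trans (cong (_% m) (trans (*-comm b x) (sym eq))) ([m+kn]%n≡m%n 1 y m)
  -- Here `1 + x * b ≡ y * m`, so the inverse of `b` is `- x`, represented by `x * pred m`.
  ... | Bézout.-+ x y eq = x * pred m , trans (sym ([m+kn]%n≡m%n (b * (x * pred m)) y m))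
        (trans (cong (_% m) lem) ([m+kn]%n≡m%n 1 (x * b) m))
    where
    open ≡-Reasoning
    lem : b * (x * pred m) + y * m ≡ 1 + x * b * m
    lem = begin
      b * (x * pred m) + y * m              ≡⟨ cong₂ _+_ (trans (sym (*-assoc b x _)) (cong (_* pred m) (*-comm b x))) (sym eq) ⟩
      x * b * pred m + suc (x * b)          ≡⟨ +-suc _ _ ⟩
      suc (x * b * pred m + x * b)          ≡⟨ cong suc (+-comm _ (x * b)) ⟩
      suc (x * b + x * b * pred m)          ≡⟨ cong suc (*-suc (x * b) (pred m)) ⟨
      suc (x * b * suc (pred m))            ≡⟨ cong (λ z → suc (x * b * z)) (suc-pred m) ⟩
      suc (x * b * m)                       ∎

  module _ (b β : ℕ) (b*β≡1 : (b * β) % m ≡ 1 % m) where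

    β*b≡1 : (β * b) % m ≡ 1 % m
    β*b≡1 = trans (cong (_% m) (*-comm β b)) b*β≡1

    scaling : Fin m ↔ Fin m
    scaling = mk↔ₛ′ (scale β) (scale b) (scale-scale b β b*β≡1) (scale-scale β b β*b≡1)

    scale-injective : ∀ {i j} → scale β i ≡ scale β j → i ≡ j
    scale-injective {i} {j} e = trans (sym (scale-scale β b β*b≡1 i)) (trans (cong (scale b) e) (scale-scale β b β*b≡1 j))

    scale-step⁺ : ∀ d {e} → (d * β) % m ≡ e % m → ∀ {u v} → Step d u v → Step e (scale β u) (scale β v)
    scale-step⁺ d dβ≡e {u} {v} (inj₁ refl) = inj₁ (trans (scale-⊞ β u d) (⊞-cong-% (scale β u) dβ≡e))
    scale-step⁺ d dβ≡e {u} {v} (inj₂ refl) = inj₂ (trans (scale-⊞ β v d) (⊞-cong-% (scale β v) dβ≡e))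

    scale-step⁻ : ∀ d {e} → (d * β) % m ≡ e % m → ∀ {u v} → Step e (scale β u) (scale β v) → Step d u v
    scale-step⁻ d dβ≡e {u} {v} (inj₁ s) = inj₁ (scale-injective (trans s (sym (trans (scale-⊞ β u d) (⊞-cong-% (scale β u) dβ≡e)))))
    scale-step⁻ d dβ≡e {u} {v} (inj₂ s) = inj₂ (scale-injective (trans s (sym (trans (scale-⊞ β v d) (⊞-cong-% (scale β v) dβ≡e)))))

    unit-hamiltonian : Hamiltonian (Step b)
    unit-hamiltonian = scaling , λ u v → mk⇔ (scale-step⁺ b b*β≡1) (scale-step⁻ b b*β≡1)

  complement-step : ∀ {t} → t ≤ m → ∀ {u v} → Step t u v → Step (m ∸ t) u v
  complement-step {t} t≤m {u} {v} (inj₁ refl) = inj₂ (sym (back u))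
    where
    back : ∀ u → u ⊞ t ⊞ (m ∸ t) ≡ u
    back u = trans (⊞-⊞ u t _) (trans (cong (u ⊞_) (trans (m+[n∸m]≡n t≤m) (sym (*-identityˡ m)))) (⊞-multiple u 1))
  complement-step {t} t≤m {u} {v} (inj₂ refl) = inj₁ (sym (trans (⊞-⊞ v t _)
    (trans (cong (v ⊞_) (trans (m+[n∸m]≡n t≤m) (sym (*-identityˡ m)))) (⊞-multiple v 1))))

-- Factorizations of circulants

double≡+ : ∀ h → double h ≡ h + h
double≡+ zero = refl
double≡+ (suc h) = cong suc (trans (cong suc (double≡+ h)) (sym (+-suc h h)))

odd-double : ∀ {n} → ¬ (2 ∣ n) → Σ ℕ λ h → n ≡ suc (double h)
odd-double {n} ¬2∣n with halve n
... | h , inj₂ e = h , e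
... | h , inj₁ e = ⊥-elim (¬2∣n (divides h (trans e (trans (double≡+ h) (trans (cong (h +_) (sym (+-identityʳ h))) (*-comm 2 h))))))

module Differences (m : ℕ) .{{_ : NonZero m}} (3≤m : 3 ≤ m) (¬2∣m : ¬ (2 ∣ m))
                   (F : List ℕ) (evens : All (2 ∣_) F) (ord : order F ≡ 2 * m) where
  open Zmod m
  open Scaling m
  open Haggkvist m 3≤m using (haggkvist)

  Factorable : (Fin m → Fin m → Set) → Set₁
  Factorable E = Factorization F (Lift E)

  from-hamiltonian : ∀ {E} → Hamiltonian E → Factorable E
  from-hamiltonian = haggkvist evens ord

  Pair : ℕ → ℕ → Fin m → Fin m → Set
  Pair a b u v = Step a u v ⊎ Step b u v

  module _ {a b r : ℕ} {c : ℕ → ℕ} where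
    open Corners m origin a b r c

    from-switching : 0 < a → 0 < b → a ≢ b → a + a < m → b + b < m →
                     Hamiltonian (Edge a b) → Hamiltonian (Edge b a) → Factorable (Pair a b)
    from-switching 0<a 0<b a≢b a+a<m b+b<m hamA hamB = factorization-cong F
      Sum.[ edge-step , (λ e → swap (edge-step e)) ]′
      Sum.[ step-edge , (λ s → swap (step-edge s)) ]′
      (factorization-∪ F (Short.edges-disjoint 0<a 0<b a≢b a+a<m b+b<m) (from-hamiltonian hamA) (from-hamiltonian hamB))

  -- The form that the zigzag needs: `d - 1`, the number of switches, is even and positive.
  odd-divisor : ∀ {d} → d ∣ m → d ≢ 1 → Σ ℕ λ h → d ≡ suc (double (suc h))
  odd-divisor d∣m d≢1 with odd-double (λ 2∣d → ¬2∣m (∣-trans 2∣d d∣m))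
  ... | zero , e = ⊥-elim (d≢1 e)
  ... | suc h , e = h , e

  module OneColumn {t N q h₀ : ℕ} (m≡ : m ≡ N * suc (double (suc h₀))) (t≡ : t ≡ q * suc (double (suc h₀)))
                   (cop : Coprime q N) (2≤t : 2 ≤ t) (t+t<m : t + t < m) where
    r d : ℕ
    r = double (suc h₀)
    d = suc r

    open Corners m origin t 1 r zig

    coprime-1 : Coprime 1 d
    coprime-1 (k∣1 , _) = ∣1⇒≡1 k∣1

    module C = Coordinates m origin t 1 d N q m≡ t≡ cop coprime-1

    0<t : 0 < t
    0<t = ≤-trans (s≤s z≤n) 2≤t

    d≤t : d ≤ t
    d≤t = ∣⇒≤ {{>-nonZero 0<t}} (divides q t≡)

    2t≡t+t : 2 * t ≡ t + t
    2t≡t+t = cong (t +_) (+-identityʳ t)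

    -- `d` divides `m` and `2 * t`, hence their positive difference. This leaves room for the third
    -- strip before the cycle closes.
    2t+d≤m : d + 2 * t ≤ m
    2t+d≤m = subst (d + 2 * t ≤_) (m∸n+n≡m 2t≤m) (+-monoˡ-≤ (2 * t) (∣⇒≤ {{>-nonZero (m<n⇒0<n∸m 2t<m)}}
               (d∣m∸2t (divides N m≡) (∣n⇒∣m*n 2 (divides q t≡)))))
      where
      2t<m : 2 * t < m
      2t<m = subst (_< m) (sym 2t≡t+t) t+t<m
      2t≤m : 2 * t ≤ m
      2t≤m = <⇒≤ 2t<m
      d∣m∸2t : d ∣ m → d ∣ 2 * t → d ∣ m ∸ 2 * t
      d∣m∸2t d∣m d∣2t = ∣m+n∣m⇒∣n (subst (d ∣_) (sym (m+[n∸m]≡n 2t≤m)) d∣m) d∣2t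

    -- Otherwise `m ≤ 2 * d ≤ 2 * t < m`. The zigzag needs three different columns in each row.
    2<N : 2 < N
    2<N = ≰⇒> λ N≤2 → <⇒≱ t+t<m (≤-trans (≤-reflexive m≡) (≤-trans (*-mono-≤ N≤2 d≤t) (≤-reflexive 2t≡t+t)))

    zig<N : ∀ {i} → i < r → suc (zig i) < N
    zig<N {i} _ = ≤-<-trans (s≤s (zig≤1 i)) 2<N

    zig-moves′ : ∀ {i} → suc i < r → zig (suc i) ≢ zig i
    zig-moves′ {i} _ = zig-moves i

    open RowCoordinates N (s≤s z≤n) C.ν-wrap C.ν-injective C.ν-surjective zig<N zig-moves′
      using (hamiltonian-a; hamiltonian-b)

    π : ℕ → Fin m
    π p = origin ⊞ p

    ν≡π : ∀ i j → ν i j ≡ π (i + j * t)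
    ν≡π i j = cong (λ z → origin ⊞ (z + j * t)) (*-identityʳ i)

    small : ∀ {i j} → i < r → j ≤ 2 → i + j * t < m
    small {i} {j} i<r j≤2 = <-≤-trans (+-mono-<-≤ (m<n⇒m<1+n i<r) (*-monoˡ-≤ t j≤2)) 2t+d≤m

    uncut : ∀ {p} → p < m → (∀ {i} → i < r → p ≢ i + zig i * t × p ≢ i + suc (zig i) * t) → ¬ Switched t (π p)
    uncut p<m free s with switched-a s
    ... | i , i<r , inj₁ e = proj₁ (free i<r) (⊞-cancel-< origin p<m
            (small {i} {zig i} i<r (≤-trans (zig≤1 i) (s≤s z≤n))) (trans e (ν≡π i (zig i))))
    ... | i , i<r , inj₂ e = proj₂ (free i<r) (⊞-cancel-< origin p<m
            (small {i} {suc (zig i)} i<r (s≤s (zig≤1 i))) (trans e (ν≡π i (suc (zig i)))))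

    wrap : π m ≡ π 0
    wrap = trans (cong π (sym (*-identityˡ m))) (trans (⊞-multiple origin 1) (sym (⊞-0 origin)))

    near-π : ∀ {i} → i < r → Star (Edge 1 t) (π (i + zig i * t)) (π (i + suc (zig i) * t))
    near-π {i} i<r = subst₂ (Edge 1 t) (ν≡π i (zig i)) (ν≡π i (suc (zig i))) (near i<r) ◅ ε

    far-π : ∀ {i} → i < r → Star (Edge 1 t) (π (suc i + zig i * t)) (π (suc i + suc (zig i) * t))
    far-π {i} i<r = subst₂ (Edge 1 t) (ν≡π (suc i) (zig i)) (ν≡π (suc i) (suc (zig i))) (far i<r) ◅ ε

    kept-π : ∀ {p} → p < m → (∀ {i} → i < r → p ≢ i + zig i * t × p ≢ i + suc (zig i) * t) →
             Star (Edge 1 t) (π p) (π (suc p))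
    kept-π {p} p<m free = subst (Edge 1 t (π p)) (trans (⊞-⊞ origin p 1) (cong π (+-comm p 1))) (kept (uncut p<m free)) ◅ ε

    open SingleColumn (star-isEquivalence {E = Edge 1 t} swap) π h₀ t m d≤t 2t+d≤m wrap near-π far-π kept-π
      using (column-bottom)

    connected : ∀ v → Star (Edge 1 t) (π 0) v
    connected v with injective⇒surjective (λ i → π (toℕ i)) (λ {i} {j} e → toℕ-injective (⊞-cancel-< origin (toℕ<n i) (toℕ<n j) e)) v
    ... | i , refl = reverse swap (column-bottom (toℕ<n i))

    factorable : Factorable (Pair t 1)
    factorable = from-switching {c = zig} 0<t (s≤s z≤n) t≢1 t+t<m 3≤m
      (hamiltonian-a 0<t (s≤s z≤n) t≢1 t+t<m 3≤m (π 0) connected) (hamiltonian-b 0<t (s≤s z≤n) t≢1 t+t<m 3≤m (π 0) connected)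
      where
      t≢1 : t ≢ 1
      t≢1 e = <⇒≢ 2≤t (sym e)

  -- Here d = L + g + 1 and e = 3 + g with L even: the first L switches stay in the columns 0, 1, 2, and the last g
  -- join the columns 3, …, e - 1 to them.
  module ManyColumns {a b N q M p h₀ g : ℕ}
                     (m≡N : m ≡ N * suc (double (suc h₀) + g)) (a≡ : a ≡ q * suc (double (suc h₀) + g)) (cop-q : Coprime q N)
                     (m≡M : m ≡ M * (3 + g)) (b≡ : b ≡ p * (3 + g)) (cop-p : Coprime p M) (cop : Coprime a b)
                     (0<a : 0 < a) (0<b : 0 < b) (a≢b : a ≢ b) (a+a<m : a + a < m) (b+b<m : b + b < m) where
    L r d e : ℕ
    L = double (suc h₀)
    r = L + g
    d = suc r
    e = 3 + g

    d∣a : d ∣ a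
    d∣a = divides q a≡
    e∣b : e ∣ b
    e∣b = divides p b≡

    open Corners m origin a b r (zigzag L)

    cop-bd : Coprime b d
    cop-bd (k∣b , k∣d) = cop (∣-trans k∣d d∣a , k∣b)

    cop-ae : Coprime a e
    cop-ae (k∣a , k∣e) = cop (k∣a , ∣-trans k∣e e∣b)

    -- Two readings of the same grid: in `R` the rows close up after `N` steps of `a`, in `C` the
    -- columns close up after `M` steps of `b`.
    module R = Coordinates m origin a b d N q m≡N a≡ cop-q cop-bd
    module C = Coordinates m origin b a e M p m≡M b≡ cop-p cop-ae

    cop-de : Coprime d e
    cop-de (k∣d , k∣e) = cop (∣-trans k∣d d∣a , ∣-trans k∣e e∣b)

    -- `e` divides `m ≡ N * d` and is coprime to `d`, hence divides `N`. So all `e` columns occur in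
    -- a row before it closes up; `d≤M` is the same for the rows.
    e≤N : e ≤ N
    e≤N = ∣⇒≤ {{R.N≢0}} (coprime-divisor {e} {d} (coprime-sym cop-de) (subst (e ∣_) (trans m≡N (*-comm N d)) (divides M m≡M)))

    d≤M : d ≤ M
    d≤M = ∣⇒≤ {{C.N≢0}} (coprime-divisor {d} {e} cop-de (subst (d ∣_) (trans m≡M (*-comm M e)) (divides N m≡N)))

    c<e : ∀ {i} → i < r → suc (zigzag L i) < e
    c<e = zigzag-bound {L} {g}

    c<N : ∀ {i} → i < r → suc (zigzag L i) < N
    c<N i<r = <-≤-trans (c<e i<r) e≤N

    c-moves : ∀ {i} → suc i < r → zigzag L (suc i) ≢ zigzag L i
    c-moves {i} _ = zigzag-moves L i

    open RowCoordinates N (s≤s z≤n) R.ν-wrap R.ν-injective R.ν-surjective c<N c-moves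
      using (hamiltonian-a; hamiltonian-b)

    ν-flip : ∀ i j → C.ν j i ≡ ν i j
    ν-flip i j = cong (origin ⊞_) (+-comm (j * a) (i * b))

    column-injective : ∀ {i j i′ j′} → i < M → i′ < M → j < e → j′ < e → ν i j ≡ ν i′ j′ → j ≡ j′ × i ≡ i′
    column-injective {i} {j} {i′} {j′} i<M i′<M j<e j′<e eq =
      C.ν-injective {j} {i} {j′} {i′} j<e j′<e i<M i′<M (trans (ν-flip i j) (trans eq (sym (ν-flip i′ j′))))

    uncut : ∀ {i j} → i < M → j < e → (i < r → j ≢ zigzag L i × j ≢ suc (zigzag L i)) → ¬ Switched a (ν i j)
    uncut {i} {j} i<M j<e free s with switched-a s
    ... | i′ , i′<r , inj₁ eq with column-injective {i} {j} {i′} {zigzag L i′} i<M (<-trans i′<r d≤M) j<e (<-trans (n<1+n _) (c<e i′<r)) eq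
    ...   | e₁ , refl = proj₁ (free i′<r) e₁
    uncut {i} {j} i<M j<e free s | i′ , i′<r , inj₂ eq with column-injective {i} {j} {i′} {suc (zigzag L i′)} i<M (<-trans i′<r d≤M) j<e (c<e i′<r) eq
    ...   | e₁ , refl = proj₂ (free i′<r) e₁

    column-wrap : ∀ j → ν M j ≡ ν 0 j
    column-wrap j = trans (sym (ν-flip M j)) (trans (C.ν-wrap j) (ν-flip 0 j))

    near′ : ∀ {i} → i < r → Star (Edge b a) (ν i (zigzag L i)) (ν i (suc (zigzag L i)))
    near′ i<r = near i<r ◅ ε

    far′ : ∀ {i} → i < r → Star (Edge b a) (ν (suc i) (zigzag L i)) (ν (suc i) (suc (zigzag L i)))
    far′ i<r = far i<r ◅ ε

    kept′ : ∀ {i j} → i < M → j < e → (i < r → j ≢ zigzag L i × j ≢ suc (zigzag L i)) →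
            Star (Edge b a) (ν i j) (ν (suc i) j)
    kept′ {i} {j} i<M j<e free = kept-b {i} {j} (uncut {i} {j} i<M j<e free) ◅ ε

    open Columns (star-isEquivalence {E = Edge b a} swap) ν h₀ g M (zigzag L) zigzag-< (zigzag-+ L) d≤M
      column-wrap near′ far′ kept′ using (column-bottom)

    connected : ∀ v → Star (Edge b a) (ν 0 0) v
    connected v with C.ν-surjective v
    ... | j , i , j<e , i<M , refl = reverse swap
            (subst (λ z → Star (Edge b a) z (ν 0 0)) (sym (ν-flip i j)) (column-bottom {i} {j} i<M j<e))

    factorable : Factorable (Pair a b)
    factorable = from-switching {c = zigzag L} 0<a 0<b a≢b a+a<m b+b<m
      (hamiltonian-a 0<a 0<b a≢b a+a<m b+b<m (ν 0 0) connected) (hamiltonian-b 0<a 0<b a≢b a+a<m b+b<m (ν 0 0) connected)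

  gcd-decomposition : ∀ a → Σ ℕ λ N → Σ ℕ λ q → m ≡ N * gcd a m × a ≡ q * gcd a m × Coprime q N
  gcd-decomposition a = m / gcd a m , a / gcd a m , sym (m/n*n≡m (gcd[m,n]∣n a m)) , sym (m/n*n≡m (gcd[m,n]∣m a m)) , coprime-/gcd a m
    where
    instance
      g≢0 : NonZero (gcd a m)
      g≢0 = ≢-nonZero (gcd[m,n]≢0 a m (inj₂ (≢-nonZero⁻¹ m)))

  hamiltonian-1 : Hamiltonian (Step 1)
  hamiltonian-1 = ↔-id _ , λ u v → mk⇔ (λ s → s) (λ s → s)

  unit-factorable : ∀ {b} → Coprime b m → Factorable (Step b)
  unit-factorable {b} cop = let β , b*β≡1 = inverse cop in from-hamiltonian (unit-hamiltonian b β b*β≡1)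

  pair-with-1 : ∀ {t} → 2 ≤ t → t + t < m → Factorable (Pair t 1)
  pair-with-1 {t} 2≤t t+t<m with coprime? t m
  ... | yes cop = factorization-∪ F (λ s s′ → <⇒≢ 2≤t (sym (step-unique 0<t t+1<m s s′)))
                    (unit-factorable cop) (from-hamiltonian hamiltonian-1)
    where
    0<t : 0 < t
    0<t = ≤-trans (s≤s z≤n) 2≤t
    t+1<m : t + 1 < m
    t+1<m = ≤-<-trans (+-monoʳ-≤ t 0<t) t+t<m
  ... | no ¬cop with odd-divisor (gcd[m,n]∣n t m) (λ e → ¬cop (gcd≡1⇒coprime e)) | gcd-decomposition t
  ...   | h₀ , e | N , q , m≡ , t≡ , cop =
          OneColumn.factorable {h₀ = h₀} (subst (λ z → m ≡ N * z) e m≡) (subst (λ z → t ≡ q * z) e t≡) cop 2≤t t+t<m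

  pull-scaling : ∀ {b β E E′} (b*β≡1 : (b * β) % m ≡ 1 % m) →
                 (∀ {u v} → E u v → E′ (scale β u) (scale β v)) → (∀ {u v} → E′ (scale β u) (scale β v) → E u v) →
                 Factorable E′ → Factorable E
  pull-scaling {b} {β} b*β≡1 to from fact = factorization-cong F from to
    (factorization-pullback F (scaling b β b*β≡1 ×-↔ ↔-id (Fin 2)) fact)

  m≢n+n : ∀ {n} → m ≢ n + n
  m≢n+n {n} e = ¬2∣m (divides n (trans e (trans (cong (n +_) (sym (+-identityʳ n))) (*-comm 2 n))))

  module _ {a b : ℕ} (0<a : 0 < a) (0<b : 0 < b) (a≢b : a ≢ b) (a+a<m : a + a < m) (b+b<m : b + b < m) where

    a+b<m : a + b < m
    a+b<m = mean-< {a} a+a<m b+b<m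

    -- Division by the unit b turns the differences a, b into ± t, 1.
    pair-with-unit : Coprime b m → Factorable (Pair a b)
    pair-with-unit cop with inverse cop
    ... | β , b*β≡1 = go
      where
      t₀ : ℕ
      t₀ = (a * β) % m
      t₀<m : t₀ < m
      t₀<m = m%n<n (a * β) m
      aβ≡t₀ : (a * β) % m ≡ t₀ % m
      aβ≡t₀ = sym (m%n%n≡m%n (a * β) m)
      reduced : ∀ {t} → (∀ {u v} → Step a u v → Step t (scale β u) (scale β v)) →
                (∀ {u v} → Step t (scale β u) (scale β v) → Step a u v) → t + t < m → Factorable (Pair a b)
      -- The values 0 and 1 of `t` would mean `a ≡ 0` and `a ≡ ± b` modulo `m`.
      reduced {0} to from _ = ⊥-elim (⊞-≢ origin 0<a (≤-<-trans (m≤m+n a b) a+b<m) (sym (scale-injective b β b*β≡1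
        (Sum.reduce (Sum.map (λ e → sym (trans e (⊞-0 _))) (λ e → trans e (⊞-0 _)) (to {origin} {origin ⊞ a} (inj₁ refl)))))))
      reduced {1} to from _ = ⊥-elim (a≢b (step-unique {u = origin} {v = origin ⊞ a} 0<a a+b<m (inj₁ refl)
        (scale-step⁻ b β b*β≡1 b b*β≡1 (to (inj₁ refl)))))
      reduced {suc (suc t)} to from t+t<m = pull-scaling {b} {β} b*β≡1 (Sum.map to (scale-step⁺ b β b*β≡1 b b*β≡1))
        (Sum.map from (scale-step⁻ b β b*β≡1 b b*β≡1)) (pair-with-1 (s≤s (s≤s z≤n)) t+t<m)
      go : Factorable (Pair a b)
      go with <-cmp (t₀ + t₀) m
      ... | tri< lt _ _ = reduced (scale-step⁺ b β b*β≡1 a aβ≡t₀) (scale-step⁻ b β b*β≡1 a aβ≡t₀) lt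
      ... | tri≈ _ e _ = ⊥-elim (m≢n+n {t₀} (sym e))
      -- Steps are undirected, so `t₀` may be replaced by `- t₀`, which lies below `m / 2`.
      ... | tri> _ _ gt = reduced {m ∸ t₀} (λ s → complement-step (<⇒≤ t₀<m) (scale-step⁺ b β b*β≡1 a aβ≡t₀ s))
              (λ s → scale-step⁻ b β b*β≡1 a aβ≡t₀ (subst (λ z → Step z _ _) (m∸[m∸n]≡n (<⇒≤ t₀<m)) (complement-step (m∸n≤m m t₀) s)))
              (begin-strict
                (m ∸ t₀) + (m ∸ t₀)  <⟨ +-monoʳ-< (m ∸ t₀) (m<n+o⇒m∸n<o m t₀ {{>-nonZero (n≢0⇒n>0 λ e → <⇒≱ gt (subst (λ z → z + z ≤ m) (sym e) z≤n))}} gt) ⟩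
                (m ∸ t₀) + t₀        ≡⟨ m∸n+n≡m (<⇒≤ t₀<m) ⟩
                m                    ∎)
        where open ≤-Reasoning

    pair-nonunits : Coprime a b → gcd a m ≢ 1 → gcd b m ≢ 1 → gcd b m < gcd a m → Factorable (Pair a b)
    pair-nonunits cop ga≢1 gb≢1 gb<ga
      with odd-divisor (gcd[m,n]∣n a m) ga≢1 | odd-divisor (gcd[m,n]∣n b m) gb≢1 | gcd-decomposition a | gcd-decomposition b
    ... | x , d≡ | y , e≡ | N , q , m≡N , a≡ , cop-q | M , p , m≡M , b≡ , cop-p =
      -- With `gcd a m ≡ 3 + 2 x` and `gcd b m ≡ 3 + 2 y`, the `2 y` columns after the first three
      -- take one switch each, and the other `2 (x - y) + 2` of the `2 x + 2` switches form the
      -- zigzag.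
      ManyColumns.factorable {h₀ = x ∸ y} {g = double y} (subst (λ z → m ≡ N * z) d≡′ m≡N) (subst (λ z → a ≡ q * z) d≡′ a≡) cop-q
        (subst (λ z → m ≡ M * z) e≡ m≡M) (subst (λ z → b ≡ p * z) e≡ b≡) cop-p cop 0<a 0<b a≢b a+a<m b+b<m
      where
      y≤x : y ≤ x
      y≤x = double-cancel-≤ (m≤n⇒m≤1+n (<⇒≤ (≤-pred (≤-pred (≤-pred (subst₂ _<_ e≡ d≡ gb<ga))))))
      double-+ : ∀ h k → double (h + k) ≡ double h + double k
      double-+ zero k = refl
      double-+ (suc h) k = cong (λ z → suc (suc z)) (double-+ h k)
      d≡′ : gcd a m ≡ suc (double (suc (x ∸ y)) + double y)
      d≡′ = trans d≡ (cong (λ z → suc (suc (suc z))) (trans (cong double (sym (m∸n+n≡m y≤x))) (double-+ (x ∸ y) y)))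

  pair-swap : ∀ {a b} → Factorable (Pair b a) → Factorable (Pair a b)
  pair-swap = factorization-cong F swap swap

  pair-factorable : ∀ {a b} → 0 < a → 0 < b → a ≢ b → a + a < m → b + b < m → Coprime a b → Factorable (Pair a b)
  pair-factorable {a} {b} 0<a 0<b a≢b a+a<m b+b<m cop with coprime? b m | coprime? a m
  ... | yes b-unit | _ = pair-with-unit 0<a 0<b a≢b a+a<m b+b<m b-unit
  ... | no _ | yes a-unit = pair-swap (pair-with-unit 0<b 0<a (λ e → a≢b (sym e)) b+b<m a+a<m a-unit)
  ... | no ¬b | no ¬a with <-cmp (gcd a m) (gcd b m)
  ...   | tri> _ _ gt = pair-nonunits 0<a 0<b a≢b a+a<m b+b<m cop (λ e → ¬a (gcd≡1⇒coprime e)) (λ e → ¬b (gcd≡1⇒coprime e)) gt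
  ...   | tri< lt _ _ = pair-swap (pair-nonunits 0<b 0<a (λ e → a≢b (sym e)) b+b<m a+a<m (coprime-sym cop)
                          (λ e → ¬b (gcd≡1⇒coprime e)) (λ e → ¬a (gcd≡1⇒coprime e)) lt)
  -- A common value of the two gcds divides both `a` and `b`, so it is 1 and `a` would be a unit.
  ...   | tri≈ _ e _ = ⊥-elim (¬a (gcd≡1⇒coprime (cop (gcd[m,n]∣m a m , subst (_∣ b) (sym e) (gcd[m,n]∣m b m)))))

  coprime-suc : ∀ s → Coprime s (suc s)
  coprime-suc s {d} (d∣s , d∣1+s) = ∣1⇒≡1 (∣m+n∣m⇒∣n (subst (d ∣_) (+-comm 1 s) d∣1+s) d∣s)

  module _ {k : ℕ} (m≡1+2k : m ≡ suc (k + k)) where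

    k+k<m : k + k < m
    k+k<m = ≤-reflexive (sym m≡1+2k)

    -- `n` counts the differences `s`, ..., `k` still to be treated. Consecutive numbers are
    -- coprime, which is what `pair-factorable` asks of the two removed at each step.
    between-factorable : ∀ n {s} → 0 < s → s + n ≡ suc k → Factorable (StepBetween s k)
    between-factorable zero {s} 0<s e = factorization-cong F (λ ())
      (λ (d , s≤d , d≤k , _) → <⇒≱ (subst (k <_) (trans (sym e) (+-identityʳ s)) (n<1+n k)) (≤-trans s≤d d≤k)) (factorization-∅ F)
    between-factorable (suc zero) {s} 0<s e with suc-injective (trans (+-comm 1 s) e)
    ... | refl = factorization-cong F (λ st → s , ≤-refl , ≤-refl , st)
            (λ (d , s≤d , d≤k , st) → subst (λ z → Step z _ _) (≤-antisym d≤k s≤d) st)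
            -- Here `s` is `k`, and a common divisor of `k` and `2 k + 1` divides 1.
            (unit-factorable λ {d} (d∣s , d∣m) → ∣1⇒≡1 (∣m+n∣m⇒∣n (subst (d ∣_) (trans m≡1+2k (+-comm 1 (s + s))) d∣m) (∣m∣n⇒∣m+n d∣s d∣s)))
    between-factorable (suc (suc n)) {s} 0<s e = factorization-cong F to from
      (factorization-∪ F disjoint
        (pair-factorable 0<s (s≤s z≤n) (<⇒≢ (n<1+n s)) (≤-<-trans (+-mono-≤ s≤k s≤k) k+k<m)
          (≤-<-trans (+-mono-≤ s<k s<k) k+k<m) (coprime-suc s))
        (between-factorable n (s≤s z≤n) (trans (cong suc (sym (+-suc s n))) (trans (sym (+-suc s (suc n))) e))))
      where
      s<k : suc s ≤ k
      s<k = ≤-pred (subst (suc (suc s) ≤_) (trans (cong suc (sym (+-suc s n))) (trans (sym (+-suc s (suc n))) e)) (s≤s (s≤s (m≤m+n s n))))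
      s≤k : s ≤ k
      s≤k = <⇒≤ s<k
      to : ∀ {u v} → Pair s (suc s) u v ⊎ StepBetween (2 + s) k u v → StepBetween s k u v
      to (inj₁ (inj₁ st)) = s , ≤-refl , s≤k , st
      to (inj₁ (inj₂ st)) = suc s , n≤1+n s , s<k , st
      to (inj₂ (d , s≤d , d≤k , st)) = d , ≤-trans (m≤n+m s 2) s≤d , d≤k , st
      from : ∀ {u v} → StepBetween s k u v → Pair s (suc s) u v ⊎ StepBetween (2 + s) k u v
      from (d , s≤d , d≤k , st) with m≤n⇒m<n∨m≡n s≤d
      ... | inj₂ refl = inj₁ (inj₁ st)
      ... | inj₁ s<d with m≤n⇒m<n∨m≡n s<d
      ...   | inj₂ refl = inj₁ (inj₂ st)
      ...   | inj₁ 1+s<d = inj₂ (d , 1+s<d , d≤k , st)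
      disjoint : ∀ {u v} → Pair s (suc s) u v → ¬ StepBetween (2 + s) k u v
      disjoint (inj₁ st) (d , s≤d , d≤k , st′) = <⇒≢ (<-trans (n<1+n s) s≤d)
        (step-unique 0<s (≤-<-trans (+-mono-≤ s≤k d≤k) k+k<m) st st′)
      disjoint (inj₂ st) (d , s≤d , d≤k , st′) = <⇒≢ s≤d
        (step-unique (s≤s z≤n) (≤-<-trans (+-mono-≤ s<k d≤k) k+k<m) st st′)

-- The complete digraph as the disjoint union of `Wstar` and the differences from 3 on

module Complete (m : ℕ) .{{_ : NonZero m}} {k : ℕ} (m≡1+2k : m ≡ suc (k + k)) where
  open Zmod m

  diffMod⇒⊞ : ∀ {i j d} → DiffMod m i j d → i ≡ j ⊞ d
  diffMod⇒⊞ {i} {j} {d} (inj₁ e) = toℕ-injective (trans e (sym (toℕ-⊞-< j d (subst (_< m) e (toℕ<n i)))))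
  diffMod⇒⊞ {i} {j} {d} (inj₂ e) = toℕ-injective (sym (trans (toℕ-⊞ j d)
    (trans (cong (_% m) (sym e)) (trans ([m+n]%n≡m%n (toℕ i) m) (m<n⇒m%n≡m (toℕ<n i))))))

  ⊞⇒diffMod : ∀ {i j d} → d < m → i ≡ j ⊞ d → DiffMod m i j d
  ⊞⇒diffMod {i} {j} {d} d<m refl with <-≤-connex (toℕ j + d) m
  ... | inj₁ lt = inj₁ (toℕ-⊞-< j d lt)
  ... | inj₂ m≤ = inj₂ (trans (cong (_+ m) (trans (toℕ-⊞ j d) lem)) (m∸n+n≡m m≤))
    where
    lem : (toℕ j + d) % m ≡ toℕ j + d ∸ m
    lem = trans (n%m≡[n∸m]%m m≤) (m<n⇒m%n≡m (+-cancelʳ-< m _ _ (subst (_< m + m) (sym (m∸n+n≡m m≤)) (+-mono-<-≤ (toℕ<n j) (<⇒≤ d<m)))))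
      where
      n%m≡[n∸m]%m : ∀ {n} → m ≤ n → n % m ≡ (n ∸ m) % m
      n%m≡[n∸m]%m {n} le = trans (cong (_% m) (sym (m∸n+n≡m le))) ([m+n]%n≡m%n (n ∸ m) m)

  ordered-distance : ∀ {u v} → toℕ u < toℕ v → StepBetween 1 k u v
  ordered-distance {u} {v} u<v with <-≤-connex k δ
    where
    δ = toℕ v ∸ toℕ u
  ... | inj₂ δ≤k = toℕ v ∸ toℕ u , m<n⇒0<n∸m u<v , δ≤k ,
        inj₁ (diffMod⇒⊞ {v} {u} (inj₁ (sym (m+[n∸m]≡n (<⇒≤ u<v)))))
  -- A difference above `k` is measured the other way round the cycle, where it is at most
  -- `m - (k + 1) ≡ k`.
  ... | inj₁ k<δ = m ∸ (toℕ v ∸ toℕ u) , m<n⇒0<n∸m δ<m ,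
        ≤-trans (∸-monoʳ-≤ m k<δ) (≤-reflexive (trans (cong (_∸ suc k) m≡1+2k) (m+n∸m≡n (suc k) k))) ,
        inj₂ (diffMod⇒⊞ {u} {v} (inj₂ lem))
    where
    δ = toℕ v ∸ toℕ u
    δ<m : δ < m
    δ<m = ≤-<-trans (m∸n≤m (toℕ v) (toℕ u)) (toℕ<n v)
    lem : toℕ u + m ≡ toℕ v + (m ∸ δ)
    lem = begin
      toℕ u + m                ≡⟨ cong (toℕ u +_) (m+[n∸m]≡n (<⇒≤ δ<m)) ⟨
      toℕ u + (δ + (m ∸ δ))    ≡⟨ +-assoc (toℕ u) δ _ ⟨
      toℕ u + δ + (m ∸ δ)      ≡⟨ cong (_+ (m ∸ δ)) (m+[n∸m]≡n (<⇒≤ u<v)) ⟩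
      toℕ v + (m ∸ δ)          ∎
      where open ≡-Reasoning

  distinct-distance : ∀ {u v} → u ≢ v → StepBetween 1 k u v
  distinct-distance {u} {v} u≢v with <-cmp (toℕ u) (toℕ v)
  ... | tri< lt _ _ = ordered-distance lt
  ... | tri≈ _ e _ = ⊥-elim (u≢v (toℕ-injective e))
  ... | tri> _ _ gt = let d , 1≤d , d≤k , s = ordered-distance gt in d , 1≤d , d≤k , swap s

  k<m : k < m
  k<m = subst (k <_) (sym m≡1+2k) (s≤s (m≤m+n k k))

  step-≢ : ∀ {d u v} → 0 < d → d ≤ k → Step d u v → u ≢ v
  step-≢ {d} {u} 0<d d≤k (inj₁ e) refl = ⊞-≢ u 0<d (≤-<-trans d≤k k<m) (sym e)
  step-≢ {d} {u} 0<d d≤k (inj₂ e) refl = ⊞-≢ u 0<d (≤-<-trans d≤k k<m) (sym e)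

  circ-step : ∀ {u v} → CircAdj m u v → Step 1 u v ⊎ Step 2 u v
  circ-step {u} {v} (inj₁ x) = inj₁ (inj₂ (diffMod⇒⊞ {u} {v} x))
  circ-step {u} {v} (inj₂ (inj₁ x)) = inj₁ (inj₁ (diffMod⇒⊞ {v} {u} x))
  circ-step {u} {v} (inj₂ (inj₂ (inj₁ x))) = inj₂ (inj₂ (diffMod⇒⊞ {u} {v} x))
  circ-step {u} {v} (inj₂ (inj₂ (inj₂ x))) = inj₂ (inj₁ (diffMod⇒⊞ {v} {u} x))

  step₁-circ : ∀ {u v} → 1 < m → Step 1 u v → CircAdj m u v
  step₁-circ {u} {v} lt (inj₂ e) = inj₁ (⊞⇒diffMod {u} {v} lt e)
  step₁-circ {u} {v} lt (inj₁ e) = inj₂ (inj₁ (⊞⇒diffMod {v} {u} lt e))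

  step₂-circ : ∀ {u v} → 2 < m → Step 2 u v → CircAdj m u v
  step₂-circ {u} {v} lt (inj₂ e) = inj₂ (inj₂ (inj₁ (⊞⇒diffMod {u} {v} lt e)))
  step₂-circ {u} {v} lt (inj₁ e) = inj₂ (inj₂ (inj₂ (⊞⇒diffMod {v} {u} lt e)))

  Far : Fin m → Fin m → Set
  Far = StepBetween 3 k

  module _ (2≤k : 2 ≤ k) where

    circ⇒between : ∀ {u v} → CircAdj m u v → StepBetween 1 2 u v
    circ⇒between c with circ-step c
    ... | inj₁ s = 1 , ≤-refl , s≤s z≤n , s
    ... | inj₂ s = 2 , s≤s z≤n , ≤-refl , s

    W-far-disjoint : ∀ {u v} → Wstar m u v → ¬ Lift Far u v
    W-far-disjoint (inj₁ (e , _)) (d , 3≤d , d≤k , s) = step-≢ (≤-trans (s≤s z≤n) 3≤d) d≤k s e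
    W-far-disjoint (inj₂ c) (d , 3≤d , d≤k , s) with circ⇒between c
    ... | d′ , 1≤d′ , d′≤2 , s′ = <⇒≢ (≤-<-trans d′≤2 3≤d)
          (step-unique 1≤d′ (subst (d′ + d <_) (sym m≡1+2k) (s≤s (+-mono-≤ (≤-trans d′≤2 2≤k) d≤k))) s′ s)

    W∪far⇒≢ : ∀ {u v} → Wstar m u v ⊎ Lift Far u v → u ≢ v
    W∪far⇒≢ (inj₁ (inj₁ (_ , a≢b))) refl = a≢b refl
    W∪far⇒≢ (inj₁ (inj₂ c)) refl with circ⇒between c
    ... | d , 1≤d , d≤2 , s = step-≢ 1≤d (≤-trans d≤2 2≤k) s refl
    W∪far⇒≢ (inj₂ (d , 3≤d , d≤k , s)) refl = step-≢ (≤-trans (s≤s z≤n) 3≤d) d≤k s refl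

    ≢⇒W∪far : ∀ {u v} → u ≢ v → Wstar m u v ⊎ Lift Far u v
    ≢⇒W∪far {i , a} {j , b} u≢v with i ≟ j
    ... | yes refl = inj₁ (inj₁ (refl , λ e → u≢v (cong (i ,_) e)))
    ... | no i≢j with distinct-distance i≢j
    ...   | 1 , _ , d≤k , s = inj₁ (inj₂ (step₁-circ (≤-<-trans d≤k k<m) s))
    ...   | 2 , _ , d≤k , s = inj₁ (inj₂ (step₂-circ (≤-<-trans d≤k k<m) s))
    ...   | suc (suc (suc d)) , _ , d≤k , s = inj₂ (_ , s≤s (s≤s (s≤s z≤n)) , d≤k , s)

theorem3p5 : (m : ℕ) → 7 ≤ m → ¬ (2 ∣ m) →
    (F : List ℕ) → IsBipartite2Factor F → order F ≡ 2 * m →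
    Factorization F (Wstar m) → Factorization F (Kstar (2 * m))
theorem3p5 m 7≤m ¬2∣m F (_ , evens) ord fact with odd-double ¬2∣m
... | k , m≡ = factorization-cong F
        (λ to-u≢to-v u≡v → to-u≢to-v (cong (Inverse.to g) u≡v))
        (λ u≢v e → u≢v (Injection.injective (↔⇒↣ g) e))
        (factorization-pullback F g (factorization-cong F (W∪far⇒≢ 2≤k) (≢⇒W∪far 2≤k)
          (factorization-∪ F (W-far-disjoint 2≤k) fact far)))
  where
  instance
    m≢0 : NonZero m
    m≢0 = >-nonZero (≤-trans (s≤s z≤n) 7≤m)
  m≡1+2k : m ≡ suc (k + k)
  m≡1+2k = trans m≡ (cong suc (double≡+ k))
  3≤k : 3 ≤ k
  3≤k = ≰⇒> λ k≤2 → <⇒≱ (s≤s (s≤s (m≤n⇒m≤1+n (+-mono-≤ k≤2 k≤2)))) (subst (7 ≤_) m≡1+2k 7≤m)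
  2≤k : 2 ≤ k
  2≤k = <⇒≤ 3≤k
  open Complete m {k = k} m≡1+2k
  far : Factorization F (Lift Far)
  -- The count `suc k ∸ 3` is the number of differences 3, ..., `k`.
  far = Differences.between-factorable m (≤-trans (s≤s (s≤s (s≤s z≤n))) 7≤m) ¬2∣m F evens ord {k = k} m≡1+2k
          (suc k ∸ 3) (s≤s z≤n) (m+[n∸m]≡n (≤-trans 3≤k (n≤1+n k)))
  g : Fin (2 * m) ↔ (Fin m × Fin 2)
  g = ×-comm (Fin 2) (Fin m) ↔-∘ *↔×
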